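{- Let $\epsilon>0$ and let $d$ be a positive integer. There exists $t_0=t_0(\epsilon,d)$ such that for every integer $t\ge t_0$ there exists a constant $K=K(\epsilon,d,t)$ with the following property. If $A$ is a finite subset of $\mathbb{Z}^d$ which is not contained in the union of any $t$ parallel (affine) hyperplanes, then there is a subset $A'\subseteq A$ with $|A'|\le K$ such that $|A+A'|\ge (2^d-\epsilon)|A|$.
   Context: A hyperplane is a translate of a $(d-1)$-dimensional linear subspace of $\mathbb{R}^d$; hyperplanes are parallel if they are translates of the same subspace. $A+A'=\{a+a':a\in A,a'\in A'\}$. -}

module Defs where

open import Data.Nat using (ℕ; zero; suc; _≤_)
open import Data.Integer as ℤ using (ℤ)
open import Data.Rational as ℚ using (ℚ; 0ℚ; _/_)
open import Data.Vec using (Vec; []; _∷_; zipWith; foldr)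
open import Data.Vec.Properties using (≡-dec)
open import Data.List as List using (List; length; deduplicate; concatMap; map)
open import Data.List.Membership.Propositional using (_∈_)
open import Data.Product using (Σ; _×_; ∃)
open import Relation.Binary.PropositionalEquality using (_≡_)
open import Relation.Nullary using (¬_)

Pt : ℕ → Set
Pt d = Vec ℤ d

_≟ᵥ_ : ∀ {d} → (x y : Pt d) → Relation.Nullary.Dec (x ≡ y)
_≟ᵥ_ = ≡-dec ℤ._≟_

_+ᵥ_ : ∀ {d} → Pt d → Pt d → Pt d
_+ᵥ_ = zipWith ℤ._+_

sumset : ∀ {d} → List (Pt d) → List (Pt d) → List (Pt d)
sumset A A' = deduplicate _≟ᵥ_ (concatMap (λ a → map (a +ᵥ_) A') A)

dotℚ : ∀ {d} → Vec ℚ d → Pt d → ℚ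
dotℚ n x = foldr _ ℚ._+_ 0ℚ (zipWith (λ c z → c ℚ.* (z / 1)) n x)

0ᵥ : ∀ d → Vec ℚ d
0ᵥ zero = []
0ᵥ (suc d) = 0ℚ ∷ 0ᵥ d

InParallelHyperplanes : ∀ {d} → ℕ → List (Pt d) → Set
InParallelHyperplanes {d} t A =
  Σ (Vec ℚ d) λ n → ¬ (n ≡ 0ᵥ d) ×
  Σ (Vec ℚ t) λ c → ∀ a → a ∈ A → ∃ λ i → dotℚ n a ≡ Data.Vec.lookup c i

module Submission where

-- Write T = |A| and suppose |A + A'| < (2ᵈ − ε) T for all bounded A' ⊆ A.
--
-- (1) If a bounded proportion of A lies over few values of a homomorphism κ, compared with the size of κ(A), then the
-- translates of this part by suitable elements of A are almost disjoint, which contradicts the assumption.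
--
-- (2) For 2ⁱ-tuples b of elements of A, the average of |A + b| is bounded and increasing in i, so for some bounded i
-- most of the sets A + b nearly coincide.  There are more pairs (b , s), with s in a fixed bounded set of elements of
-- A, than values of b + s, so b + s = b' + s' for some such b and b' with s ≠ s'.  Then A + b is nearly invariant
-- under v = s − s', so it consists of few lines in direction v, and hence so does A.
--
-- (3) Project along v to ℤᵈ⁻¹.  For a suitable unit u and bounded s, let L(s) be the set of rows with at least s u
-- points; by (1), the bounded s account for nearly all of A.  By (1) again and induction, L(s) is either negligible or
-- satisfies |L(s) + J| ≥ (2ᵈ⁻¹ − ε) |L(s)| for a bounded J ⊆ L(s).  Each row of A over L(s) + J can be made to have
-- almost 2 s u points with three summands from each row over J, and summing over s yields a contradiction.
--
-- Since bounded subsets of A can be searched exhaustively, the argument by contradiction is constructive.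


-- Only sumsets with boundedly many summands are known to be small. Nothing bounds A + A, so
-- structure theorems for sets of small doubling do not apply; tuples of bounded length still yield
-- an almost period.
--
-- Row sizes may vary widely, so a bound for the projection of A alone says too little. Up to
-- rounding, T is u times the sum of the |L(s)|, and rows over i and j in L(s) with s u points each
-- produce 2 s u - 1 points over i + j. Collecting these for all s gives about 2 u times the sum of
-- the |L(s) + J(s)|, so the dimension gained contributes the factor 2.
--
-- All losses are governed by one parameter g, a multiple of 1/ε. The almost period is precise
-- enough to leave at most T / g² rows. Hence u can be about 1/g of the mean row size and still at
-- least g: rounding to multiples of u loses T / g, and the missing 1 in 2 s u - 1 is a 1/g share of
-- u. For r of order g², rows with r u points are so rare that (1) makes them negligible, and a
-- level carrying less than T / (g r) may be dropped, as there are only r levels.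

module _ where

  open import Defs
  open import Data.Empty using (⊥-elim)
  open import Data.Fin using (zero; suc)
  open import Data.Integer as ℤ using (ℤ; -[1+_]; +[1+_]; 0ℤ) renaming (+_ to pos)
  import Data.Integer.Properties as ℤ
  open import Data.Integer.DivMod using (_%ℕ_; _/ℕ_; a≡a%ℕn+[a/ℕn]*n; n%ℕd<d)
  open import Data.Integer.Tactic.RingSolver using () renaming (solve-∀ to solve-∀-ℤ)
  open import Data.List using (List; []; _∷_; _++_; length; map; filter; take; cartesianProduct; cartesianProductWith; concatMap; deduplicate)
  open import Data.List.Extrema ℤ.≤-totalOrder using (argmin; argmax; argmin-sel; argmax-sel; f[argmin]≤f[⊤]; f[argmin]≤f[xs]; f[⊥]≤f[argmax]; f[xs]≤f[argmax])
  open import Data.List.Membership.Propositional using (_∈_; _∉_; find; lose)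
  open import Data.List.Membership.Propositional.Properties
  open import Data.List.Properties using (length-++; length-map; length-take; length-deduplicate; map-++)
  open import Data.List.Relation.Binary.Subset.Propositional using (_⊆_)
  open import Data.List.Relation.Unary.All as All using ([]; _∷_)
  import Data.List.Relation.Unary.All.Properties as All
  open import Data.List.Relation.Unary.AllPairs using ([]; _∷_)
  open import Data.List.Relation.Unary.Any using (Any; here; there; any?)
  open import Data.List.Relation.Unary.Unique.Propositional using (Unique)
  import Data.List.Relation.Unary.Unique.DecPropositional.Properties as DecUnique
  import Data.List.Relation.Unary.Unique.Propositional.Properties as Unique
  import Data.Nat as ℕ
  open import Data.Nat using (ℕ; zero; suc; pred; _+_; _*_; _∸_; _^_; _≤_; _<_; z≤n; s≤s; s≤s⁻¹; _≤?_; _<?_; NonZero; >-nonZero; >-nonZero⁻¹; ≢-nonZero)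
  open import Data.Nat.Coprimality using (1-coprimeTo) renaming (sym to coprime-sym)
  open import Data.Nat.DivMod using (_/_; _%_; m≡m%n+[m/n]*n; m%n<n)
  open import Data.Nat.Properties
  open import Data.Nat.Tactic.RingSolver using (solve-∀)
  open import Data.Product using (Σ; ∃; _×_; _,_; proj₁; proj₂)
  open import Data.Product.Properties using () renaming (≡-dec to ×-≡-dec)
  open import Data.Rational as ℚ using (ℚ; 0ℚ; 1ℚ; mkℚ)
  import Data.Rational.Properties as ℚ
  open import Data.Rational.Solver using (module +-*-Solver)
  import Data.Rational.Unnormalised as ℚᵘ
  import Data.Rational.Unnormalised.Properties as ℚᵘ
  open import Data.Sum using (_⊎_; inj₁; inj₂; [_,_]′)
  open import Data.Vec as Vec using (Vec; []; _∷_; zipWith; replicate)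
  import Data.Vec.Properties as Vec
  open import Function using (_∘_; id)
  open import Relation.Binary using (DecidableEquality)
  open import Relation.Binary.PropositionalEquality using (_≡_; _≢_; refl; sym; trans; cong; cong₂; subst; subst₂; module ≡-Reasoning)
  open import Relation.Nullary using (¬_; Dec; yes; no; ¬?)
  open import Relation.Nullary.Decidable using (map′; _⊎-dec_)
  open import Relation.Unary using (Decidable)
  import Algebra.Properties.AbelianGroup ℤ.+-0-abelianGroup as ℤ+
  import Algebra.Properties.AbelianGroup ℚ.+-0-abelianGroup as ℚ+

  private variable
    X Y Z : Set
    d : ℕ

  -- Finite sums and counting

  ∑ : List X → (X → ℕ) → ℕ
  ∑ [] f = 0
  ∑ (x ∷ xs) f = f x + ∑ xs f

  ∑-mono : ∀ (xs : List X) {f g : X → ℕ} → (∀ {x} → x ∈ xs → f x ≤ g x) → ∑ xs f ≤ ∑ xs g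
  ∑-mono [] f≤g = z≤n
  ∑-mono (x ∷ xs) f≤g = +-mono-≤ (f≤g (here refl)) (∑-mono xs (f≤g ∘ there))

  ∑-cong : ∀ (xs : List X) {f g : X → ℕ} → (∀ {x} → x ∈ xs → f x ≡ g x) → ∑ xs f ≡ ∑ xs g
  ∑-cong [] f≡g = refl
  ∑-cong (x ∷ xs) f≡g = cong₂ _+_ (f≡g (here refl)) (∑-cong xs (f≡g ∘ there))

  ∑-distrib-+ : ∀ (xs : List X) (f g : X → ℕ) → ∑ xs (λ x → f x + g x) ≡ ∑ xs f + ∑ xs g
  ∑-distrib-+ [] f g = refl
  ∑-distrib-+ (x ∷ xs) f g rewrite ∑-distrib-+ xs f g = lem (f x) (g x) (∑ xs f) (∑ xs g)
    where
    lem : ∀ a b c d → a + b + (c + d) ≡ a + c + (b + d)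
    lem = solve-∀

  *-distribˡ-∑ : ∀ c (xs : List X) (f : X → ℕ) → c * ∑ xs f ≡ ∑ xs (λ x → c * f x)
  *-distribˡ-∑ c [] f = *-zeroʳ c
  *-distribˡ-∑ c (x ∷ xs) f = trans (*-distribˡ-+ c (f x) _) (cong (c * f x +_) (*-distribˡ-∑ c xs f))

  ∑-const : ∀ (xs : List X) c → ∑ xs (λ _ → c) ≡ length xs * c
  ∑-const [] c = refl
  ∑-const (x ∷ xs) c = cong (c +_) (∑-const xs c)

  ∑-comm : ∀ (xs : List X) (ys : List Y) (f : X → Y → ℕ) →
    ∑ xs (λ x → ∑ ys (f x)) ≡ ∑ ys (λ y → ∑ xs (λ x → f x y))
  ∑-comm [] ys f = sym (trans (∑-const ys 0) (*-zeroʳ (length ys)))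
  ∑-comm (x ∷ xs) ys f = trans (cong (∑ ys (f x) +_) (∑-comm xs ys f))
    (sym (∑-distrib-+ ys (f x) (λ y → ∑ xs (λ x → f x y))))

  ∑-++ : ∀ (xs ys : List X) (f : X → ℕ) → ∑ (xs ++ ys) f ≡ ∑ xs f + ∑ ys f
  ∑-++ [] ys f = refl
  ∑-++ (x ∷ xs) ys f = trans (cong (f x +_) (∑-++ xs ys f)) (sym (+-assoc (f x) _ _))

  ∑-map : ∀ (g : X → Y) (xs : List X) (f : Y → ℕ) → ∑ (map g xs) f ≡ ∑ xs (f ∘ g)
  ∑-map g [] f = refl
  ∑-map g (x ∷ xs) f = cong (f (g x) +_) (∑-map g xs f)

  ∑-cartesianProduct : ∀ (xs : List X) (ys : List Y) (f : X × Y → ℕ) →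
    ∑ (cartesianProduct xs ys) f ≡ ∑ xs (λ x → ∑ ys (λ y → f (x , y)))
  ∑-cartesianProduct [] ys f = refl
  ∑-cartesianProduct (x ∷ xs) ys f = trans (∑-++ (map (x ,_) ys) _ f)
    (cong₂ _+_ (∑-map (x ,_) ys f) (∑-cartesianProduct xs ys f))

  ∑-mono-< : ∀ (xs : List X) {f g : X → ℕ} → 0 < length xs →
    (∀ {x} → x ∈ xs → f x < g x) → ∑ xs f < ∑ xs g
  ∑-mono-< (x ∷ xs) _ f<g = +-mono-<-≤ (f<g (here refl)) (∑-mono xs (<⇒≤ ∘ f<g ∘ there))

  -- The averaging principle behind all later choices: of a translate, of a central tuple, of the
  -- middle one of three summands. Decidability of ≤ makes the choice effective.
  ∑-≤⇒∃≤ : ∀ (xs : List X) {f g : X → ℕ} → 0 < length xs → ∑ xs f ≤ ∑ xs g →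
    ∃ λ x → x ∈ xs × f x ≤ g x
  ∑-≤⇒∃≤ xs {f} {g} 0<xs ∑f≤∑g with any? (λ x → f x ≤? g x) xs
  ... | yes p = find p
  ... | no ¬p = ⊥-elim (<⇒≱ (∑-mono-< xs 0<xs (λ x∈ → ≰⇒> (λ q → ¬p (lose x∈ q)))) ∑f≤∑g)

  ∑≡0 : ∀ (xs : List X) {f : X → ℕ} → (∀ {x} → x ∈ xs → f x ≡ 0) → ∑ xs f ≡ 0
  ∑≡0 xs f≡0 = trans (∑-cong xs f≡0) (trans (∑-const xs 0) (*-zeroʳ (length xs)))

  ∈⇒≤∑ : ∀ {xs : List X} {x} (f : X → ℕ) → x ∈ xs → f x ≤ ∑ xs f
  ∈⇒≤∑ f (here refl) = m≤m+n _ _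
  ∈⇒≤∑ f (there x∈) = m≤n⇒m≤o+n _ (∈⇒≤∑ f x∈)

  ⟦_⟧ : ∀ {A : Set} → Dec A → ℕ
  ⟦ yes _ ⟧ = 1
  ⟦ no _ ⟧ = 0

  count : {P : X → Set} → Decidable P → List X → ℕ
  count P? xs = ∑ xs (λ x → ⟦ P? x ⟧)

  length-filter≡count : {P : X → Set} (P? : Decidable P) → ∀ xs → length (filter P? xs) ≡ count P? xs
  length-filter≡count P? [] = refl
  length-filter≡count P? (x ∷ xs) with P? x
  ... | yes _ = cong suc (length-filter≡count P? xs)
  ... | no _ = length-filter≡count P? xs

  count+count-¬ : {P : X → Set} (P? : Decidable P) → ∀ xs → count P? xs + count (¬? ∘ P?) xs ≡ length xs
  count+count-¬ P? xs = begin
    count P? xs + count (¬? ∘ P?) xs     ≡⟨ ∑-distrib-+ xs _ _ ⟨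
    ∑ xs (λ x → ⟦ P? x ⟧ + ⟦ ¬? (P? x) ⟧) ≡⟨ ∑-cong xs (λ {x} _ → lem (P? x)) ⟩
    ∑ xs (λ _ → 1)                        ≡⟨ ∑-const xs 1 ⟩
    length xs * 1                         ≡⟨ *-identityʳ _ ⟩
    length xs ∎
    where
    open ≡-Reasoning
    lem : ∀ {A : Set} (d : Dec A) → ⟦ d ⟧ + ⟦ ¬? d ⟧ ≡ 1
    lem (yes _) = refl
    lem (no _) = refl

  ∑-filter : {P : X → Set} (P? : Decidable P) → ∀ xs f → ∑ (filter P? xs) f ≡ ∑ xs (λ x → ⟦ P? x ⟧ * f x)
  ∑-filter P? [] f = refl
  ∑-filter P? (x ∷ xs) f with P? x
  ... | yes _ = cong₂ _+_ (sym (+-identityʳ (f x))) (∑-filter P? xs f)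
  ... | no _ = ∑-filter P? xs f

  ⊆-length : ∀ {xs ys : List X} → Unique xs → xs ⊆ ys → length xs ≤ length ys
  ⊆-length {xs = []} _ _ = z≤n
  ⊆-length {xs = x ∷ xs} {ys} (x∉ ∷ u) xs⊆ys with ∈-∃++ (xs⊆ys (here refl))
  ... | as , bs , refl = begin
    suc (length xs)              ≤⟨ s≤s (⊆-length u drop-x) ⟩
    suc (length (as ++ bs))      ≡⟨ cong suc (length-++ as) ⟩
    suc (length as + length bs)  ≡⟨ +-suc (length as) (length bs) ⟨
    length as + suc (length bs)  ≡⟨ length-++ as ⟨
    length (as ++ x ∷ bs) ∎
    where
    open ≤-Reasoning
    drop-x : xs ⊆ as ++ bs
    drop-x {y} y∈ with ∈-++⁻ as (xs⊆ys (there y∈))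
    ... | inj₁ y∈as = ∈-++⁺ˡ y∈as
    ... | inj₂ (here refl) = ⊥-elim (All.lookup x∉ y∈ refl)
    ... | inj₂ (there y∈bs) = ∈-++⁺ʳ as y∈bs

  map-unique : ∀ {xs : List X} {f : X → Y} → Unique xs →
    (∀ {x y} → x ∈ xs → y ∈ xs → f x ≡ f y → x ≡ y) → Unique (map f xs)
  map-unique [] inj = []
  map-unique {f = f} (x∉ ∷ u) inj =
    All.map⁺ (All.tabulate (λ y∈ fx≡fy → All.lookup x∉ y∈ (inj (here refl) (there y∈) fx≡fy)))
    ∷ map-unique u (λ x∈ y∈ → inj (there x∈) (there y∈))

  map-unique⁻ : ∀ {xs : List X} {f : X → Y} → Unique (map f xs) →
    ∀ {x y} → x ∈ xs → y ∈ xs → f x ≡ f y → x ≡ y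
  map-unique⁻ u (here refl) (here refl) _ = refl
  map-unique⁻ {f = f} (x∉ ∷ _) (here refl) (there y∈) eq = ⊥-elim (All.lookup x∉ (∈-map⁺ f y∈) eq)
  map-unique⁻ {f = f} (x∉ ∷ _) (there x∈) (here refl) eq = ⊥-elim (All.lookup x∉ (∈-map⁺ f x∈) (sym eq))
  map-unique⁻ (_ ∷ u) (there x∈) (there y∈) eq = map-unique⁻ u x∈ y∈ eq

  injection-length : ∀ {xs : List X} {ys : List Y} (f : X → Y) → Unique xs →
    (∀ {x y} → x ∈ xs → y ∈ xs → f x ≡ f y → x ≡ y) → (∀ {x} → x ∈ xs → f x ∈ ys) →
    length xs ≤ length ys
  injection-length {xs = xs} {ys} f u inj into = subst (_≤ length ys) (length-map f xs)
    (⊆-length (map-unique u inj) λ y∈ → let (x , x∈ , y≡fx) = ∈-map⁻ f y∈ in subst (_∈ ys) (sym y≡fx) (into x∈))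

  pigeonhole : ∀ {xs : List X} {ys : List Y} (f : X → Y) → DecidableEquality Y → Unique xs →
    (∀ {x} → x ∈ xs → f x ∈ ys) → length ys < length xs →
    ∃ λ x → ∃ λ y → x ∈ xs × y ∈ xs × x ≢ y × f x ≡ f y
  pigeonhole {X = X} {xs = xs} {ys} f _≟_ u into ys<xs with collision xs u
    where
    collision : ∀ zs → Unique zs →
      Unique (map f zs) ⊎ (∃ λ x → ∃ λ y → x ∈ zs × y ∈ zs × x ≢ y × f x ≡ f y)
    collision [] _ = inj₁ []
    collision (z ∷ zs) (z∉ ∷ u) with any? (λ y → f z ≟ f y) zs
    ... | yes p = let (y , y∈ , eq) = find p in
      inj₂ (z , y , here refl , there y∈ , All.lookup z∉ y∈ , eq)
    ... | no ¬p with collision zs u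
    ...   | inj₁ u' = inj₁ (All.map⁺ (All.¬Any⇒All¬ zs ¬p) ∷ u')
    ...   | inj₂ (x , y , x∈ , y∈ , r) = inj₂ (x , y , there x∈ , there y∈ , r)
  ... | inj₂ c = c
  ... | inj₁ u' = ⊥-elim (<⇒≱ ys<xs (injection-length f u (map-unique⁻ u') into))

  module Fibres (_≟_ : DecidableEquality Y) (κ : X → Y) where

    fibre : Y → List X → List X
    fibre k = filter (λ x → κ x ≟ k)

    private
      -- Double counting of the pairs with `κ z ≡ k`. The two bounds below follow because a key
      -- occurs at most once in a list without repetitions, and at least once in a covering list.
      fibres≡ : ∀ ks zs → ∑ ks (λ k → length (fibre k zs)) ≡ ∑ zs (λ z → length (filter (κ z ≟_) ks))
      fibres≡ ks zs = begin
        ∑ ks (λ k → length (fibre k zs))           ≡⟨ ∑-cong ks (λ {k} _ → length-filter≡count (λ x → κ x ≟ k) zs) ⟩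
        ∑ ks (λ k → ∑ zs (λ z → ⟦ κ z ≟ k ⟧))       ≡⟨ ∑-comm ks zs (λ k z → ⟦ κ z ≟ k ⟧) ⟩
        ∑ zs (λ z → ∑ ks (λ k → ⟦ κ z ≟ k ⟧))       ≡⟨ ∑-cong zs (λ {z} _ → length-filter≡count (κ z ≟_) ks) ⟨
        ∑ zs (λ z → length (filter (κ z ≟_) ks)) ∎
        where open ≡-Reasoning

    ∑-fibres-≤ : ∀ {ks} → Unique ks → ∀ zs → ∑ ks (λ k → length (fibre k zs)) ≤ length zs
    ∑-fibres-≤ {ks} u zs = begin
      ∑ ks (λ k → length (fibre k zs))          ≡⟨ fibres≡ ks zs ⟩
      ∑ zs (λ z → length (filter (κ z ≟_) ks))  ≤⟨ ∑-mono zs (λ {z} _ → ⊆-length {ys = κ z ∷ []}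
                                                      (Unique.filter⁺ (κ z ≟_) u)
                                                      (λ k∈ → here (sym (proj₂ (∈-filter⁻ (κ z ≟_) {xs = ks} k∈))))) ⟩
      ∑ zs (λ _ → 1)                            ≡⟨ ∑-const zs 1 ⟩
      length zs * 1                             ≡⟨ *-identityʳ _ ⟩
      length zs ∎
      where open ≤-Reasoning

    length≤∑-fibres : ∀ {ks zs} → (∀ {z} → z ∈ zs → κ z ∈ ks) → length zs ≤ ∑ ks (λ k → length (fibre k zs))
    length≤∑-fibres {ks} {zs} cover = begin
      length zs                                 ≡⟨ *-identityʳ _ ⟨
      length zs * 1                             ≡⟨ ∑-const zs 1 ⟨
      ∑ zs (λ _ → 1)                            ≤⟨ ∑-mono zs (λ {z} z∈ → ∈-length (∈-filter⁺ (κ z ≟_) (cover z∈) refl)) ⟩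
      ∑ zs (λ z → length (filter (κ z ≟_) ks))  ≡⟨ fibres≡ ks zs ⟨
      ∑ ks (λ k → length (fibre k zs)) ∎
      where open ≤-Reasoning

    -- Values are represented by elements because translations have to be by elements of A, not by
    -- elements of its image.
    reps : List X → List X
    reps [] = []
    reps (x ∷ xs) with any? (κ x ≟_) (map κ (reps xs))
    ... | yes _ = reps xs
    ... | no _ = x ∷ reps xs

    reps-⊆ : ∀ xs → reps xs ⊆ xs
    reps-⊆ (x ∷ xs) y∈ with any? (κ x ≟_) (map κ (reps xs))
    ... | yes _ = there (reps-⊆ xs y∈)
    ... | no _ with y∈
    ...   | here refl = here refl
    ...   | there y∈' = there (reps-⊆ xs y∈')

    keys : List X → List Y
    keys xs = map κ (reps xs)

    keys-unique : ∀ xs → Unique (keys xs)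
    keys-unique [] = []
    keys-unique (x ∷ xs) with any? (κ x ≟_) (map κ (reps xs))
    ... | yes _ = keys-unique xs
    ... | no ¬p = All.¬Any⇒All¬ _ ¬p ∷ keys-unique xs

    ∈-keys : ∀ {xs x} → x ∈ xs → κ x ∈ keys xs
    ∈-keys {x ∷ xs} x∈ with any? (κ x ≟_) (map κ (reps xs)) | x∈
    ... | yes p | here refl = p
    ... | yes p | there x∈' = ∈-keys x∈'
    ... | no _  | here refl = here refl
    ... | no _  | there x∈' = there (∈-keys x∈')

    ∈-keys⁻ : ∀ {xs k} → k ∈ keys xs → ∃ λ x → x ∈ xs × k ≡ κ x
    ∈-keys⁻ {xs} k∈ = let (x , x∈ , eq) = ∈-map⁻ κ k∈ in x , reps-⊆ xs x∈ , eq

    reps-unique : ∀ xs → Unique (reps xs)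
    reps-unique [] = []
    reps-unique (x ∷ xs) with any? (κ x ≟_) (map κ (reps xs))
    ... | yes _ = reps-unique xs
    ... | no ¬p = All.tabulate (λ y∈ eq → ¬p (subst (λ z → κ z ∈ map κ (reps xs)) (sym eq) (∈-map⁺ κ y∈))) ∷ reps-unique xs

  length-cartesianProductWith : ∀ (f : X → Y → Z) xs ys →
    length (cartesianProductWith f xs ys) ≡ length xs * length ys
  length-cartesianProductWith f [] ys = refl
  length-cartesianProductWith f (x ∷ xs) ys = trans (length-++ (map (f x) ys))
    (cong₂ _+_ (length-map (f x) ys) (length-cartesianProductWith f xs ys))

  ∃⊆? : {P : List X → Set} → (∀ xs → Dec (P xs)) → ∀ K A →
    Dec (∃ λ xs → xs ⊆ A × length xs ≤ K × P xs)
  ∃⊆? {P = P} P? zero A = map′ (λ p → [] , (λ ()) , z≤n , p) (λ { ([] , _ , _ , p) → p }) (P? [])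
  ∃⊆? {P = P} P? (suc K) A =
    map′ to from (P? [] ⊎-dec any? (λ a → ∃⊆? (λ xs → P? (a ∷ xs)) K A) A)
    where
    Split = P [] ⊎ Any (λ a → ∃ λ xs → xs ⊆ A × length xs ≤ K × P (a ∷ xs)) A
    to : Split → ∃ λ xs → xs ⊆ A × length xs ≤ suc K × P xs
    to (inj₁ p) = [] , (λ ()) , z≤n , p
    to (inj₂ q) = let (a , a∈ , xs , xs⊆ , len , p) = find q in
      a ∷ xs , (λ { (here refl) → a∈ ; (there x∈) → xs⊆ x∈ }) , s≤s len , p
    from : (∃ λ xs → xs ⊆ A × length xs ≤ suc K × P xs) → Split
    from ([] , _ , _ , p) = inj₁ p
    from (a ∷ xs , ⊆A , s≤s len , p) = inj₂ (lose (⊆A (here refl)) (xs , (λ x∈ → ⊆A (there x∈)) , len , p))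

  -- The group ℤᵈ and sumsets

  _-ᵥ_ : Pt d → Pt d → Pt d
  _-ᵥ_ = zipWith ℤ._-_

  +ᵥ-comm : (x y : Pt d) → x +ᵥ y ≡ y +ᵥ x
  +ᵥ-comm = Vec.zipWith-comm ℤ.+-comm

  +ᵥ-assoc : (x y z : Pt d) → (x +ᵥ y) +ᵥ z ≡ x +ᵥ (y +ᵥ z)
  +ᵥ-assoc = Vec.zipWith-assoc ℤ.+-assoc

  +ᵥ-cancelˡ : (z x y : Pt d) → z +ᵥ x ≡ z +ᵥ y → x ≡ y
  +ᵥ-cancelˡ [] [] [] _ = refl
  +ᵥ-cancelˡ (c ∷ z) (a ∷ x) (b ∷ y) eq = cong₂ _∷_
    (ℤ+.∙-cancelˡ c a b (Vec.∷-injectiveˡ eq)) (+ᵥ-cancelˡ z x y (Vec.∷-injectiveʳ eq))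

  +ᵥ-cancelʳ : (z x y : Pt d) → x +ᵥ z ≡ y +ᵥ z → x ≡ y
  +ᵥ-cancelʳ z x y eq = +ᵥ-cancelˡ z x y (trans (+ᵥ-comm z x) (trans eq (+ᵥ-comm y z)))

  x-y+y≡x : (x y : Pt d) → (x -ᵥ y) +ᵥ y ≡ x
  x-y+y≡x [] [] = refl
  x-y+y≡x (a ∷ x) (b ∷ y) = cong₂ _∷_
    (trans (ℤ.+-assoc a (ℤ.- b) b) (trans (cong (λ c → a ℤ.+ c) (ℤ.+-inverseˡ b)) (ℤ.+-identityʳ a)))
    (x-y+y≡x x y)

  module _ {d : ℕ} where

    open import Data.List.Membership.DecPropositional (_≟ᵥ_ {d}) public using () renaming (_∈?_ to _∈ᵥ?_)

    private
      sums : List (Pt d) → List (Pt d) → List (Pt d)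
      sums A B = concatMap (λ a → map (a +ᵥ_) B) A

    sumset-unique : ∀ A B → Unique (sumset A B)
    sumset-unique A B = DecUnique.deduplicate-! _≟ᵥ_ (sums A B)

    ∈-sumset⁺ : ∀ {A B} {a b : Pt d} → a ∈ A → b ∈ B → a +ᵥ b ∈ sumset A B
    ∈-sumset⁺ {A} {B} {a} a∈ b∈ =
      ∈-deduplicate⁺ _≟ᵥ_ (∈-concatMap⁺ (λ a → map (a +ᵥ_) B) (lose a∈ (∈-map⁺ (a +ᵥ_) b∈)))

    ∈-sumset⁻ : ∀ A B {z : Pt d} → z ∈ sumset A B → ∃ λ a → ∃ λ b → a ∈ A × b ∈ B × z ≡ a +ᵥ b
    ∈-sumset⁻ A B z∈ =
      let (a , a∈ , z∈') = find (∈-concatMap⁻ (λ a → map (a +ᵥ_) B) {xs = A} (∈-deduplicate⁻ _≟ᵥ_ (sums A B) z∈))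
          (b , b∈ , eq) = ∈-map⁻ (a +ᵥ_) z∈'
      in a , b , a∈ , b∈ , eq

    sumset-mono : ∀ {A A' B B' : List (Pt d)} → A ⊆ A' → B ⊆ B' → sumset A B ⊆ sumset A' B'
    sumset-mono {A} {B = B} A⊆ B⊆ z∈ with ∈-sumset⁻ A B z∈
    ... | a , b , a∈ , b∈ , refl = ∈-sumset⁺ (A⊆ a∈) (B⊆ b∈)

    length-sumset-mono : ∀ {A A' B B' : List (Pt d)} → A ⊆ A' → B ⊆ B' →
      length (sumset A B) ≤ length (sumset A' B')
    length-sumset-mono {A} {B = B} A⊆ B⊆ = ⊆-length (sumset-unique A B) (sumset-mono A⊆ B⊆)

  -- If the image of B under κ is small compared with that of R, then
  -- translates of B by suitable elements of R are essentially disjoint.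

  private
    2[x+y]≡2x+2y : ∀ x y → 2 * (x + y) ≡ 2 * x + 2 * y
    2[x+y]≡2x+2y = solve-∀

    2[bw]≡2wb : ∀ b w → 2 * (b * w) ≡ 2 * w * b
    2[bw]≡2wb = solve-∀

  module Spreading {d} {Y : Set} (_≟_ : DecidableEquality Y) (_⊕_ : Y → Y → Y)
    (⊕-cancelˡ : ∀ y {a b} → y ⊕ a ≡ y ⊕ b → a ≡ b)
    (κ : Pt d → Y) (κ-+ : ∀ x y → κ (x +ᵥ y) ≡ κ x ⊕ κ y) where

    open import Data.List.Membership.DecPropositional _≟_ using (_∈?_)

    private
      module _ (W : List Y) where

        hit? : ∀ a b → Dec (κ b ⊕ κ a ∈ W)
        hit? a b = (κ b ⊕ κ a) ∈? W

        -- By cancellation and injectivity of `κ` on R, each b is carried into W by at most |W|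
        -- elements of R. On average over R, therefore, at most half of B is carried into W.
        missing-translate : ∀ {B R : List (Pt d)} → Unique (map κ R) → 0 < length R → 2 * length W ≤ length R →
          ∃ λ a → a ∈ R × 2 * count (hit? a) B ≤ length B
        missing-translate {B} {R} uR 0<R |W|≤ = ∑-≤⇒∃≤ R 0<R (begin
          ∑ R (λ a → 2 * count (hit? a) B)     ≡⟨ *-distribˡ-∑ 2 R _ ⟨
          2 * ∑ R (λ a → count (hit? a) B)     ≡⟨ cong (2 *_) (∑-comm R B (λ a b → ⟦ hit? a b ⟧)) ⟩
          2 * ∑ B (λ b → count (λ a → hit? a b) R) ≤⟨ *-monoʳ-≤ 2 (∑-mono B (λ {b} _ → hits-by b)) ⟩
          2 * ∑ B (λ b → length W)             ≡⟨ cong (2 *_) (∑-const B (length W)) ⟩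
          2 * (length B * length W)            ≡⟨ 2[bw]≡2wb (length B) (length W) ⟩
          2 * length W * length B              ≤⟨ *-monoˡ-≤ (length B) |W|≤ ⟩
          length R * length B                  ≡⟨ ∑-const R (length B) ⟨
          ∑ R (λ _ → length B) ∎)
          where
          open ≤-Reasoning
          inR : ∀ b {x} → x ∈ filter (λ a → hit? a b) R → x ∈ R
          inR b x∈ = proj₁ (∈-filter⁻ (λ a → hit? a b) {xs = R} x∈)

          hits-by : ∀ b → count (λ a → hit? a b) R ≤ length W
          hits-by b = begin
            count (λ a → hit? a b) R             ≡⟨ length-filter≡count (λ a → hit? a b) R ⟨
            length (filter (λ a → hit? a b) R)   ≤⟨ injection-length (λ a → κ b ⊕ κ a)
                                                      (Unique.filter⁺ (λ a → hit? a b) (Unique.map⁻ uR))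
                                                      (λ x∈ y∈ eq → map-unique⁻ uR (inR b x∈) (inR b y∈) (⊕-cancelˡ (κ b) eq))
                                                      (λ x∈ → proj₂ (∈-filter⁻ (λ a → hit? a b) {xs = R} x∈)) ⟩
            length W ∎

        -- All old sums have their `κ`-value in W, so those b + a whose value avoids W are new; they
        -- are at least half of B + a.
        gain : ∀ {B A'} a → Unique B → (∀ {z} → z ∈ sumset B A' → κ z ∈ W) →
          2 * count (hit? a) B ≤ length B →
          length B + 2 * length (sumset B A') ≤ 2 * length (sumset B (a ∷ A'))
        gain {B} {A'} a uB old-hit few = begin
          length B + 2 * length (sumset B A')
            ≤⟨ +-monoˡ-≤ _ half ⟩
          2 * length fresh + 2 * length (sumset B A')
            ≡⟨ 2[x+y]≡2x+2y (length fresh) (length (sumset B A')) ⟨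
          2 * (length fresh + length (sumset B A'))
            ≡⟨ cong (λ l → 2 * (l + length (sumset B A'))) (length-map (_+ᵥ a) fresh) ⟨
          2 * (length (map (_+ᵥ a) fresh) + length (sumset B A'))
            ≡⟨ cong (2 *_) (length-++ (map (_+ᵥ a) fresh)) ⟨
          2 * length (map (_+ᵥ a) fresh ++ sumset B A')
            ≤⟨ *-monoʳ-≤ 2 (⊆-length unique included) ⟩
          2 * length (sumset B (a ∷ A')) ∎
          where
          open ≤-Reasoning

          fresh : List (Pt d)
          fresh = filter (¬? ∘ hit? a) B

          disjoint : ∀ {z} → ¬ (z ∈ map (_+ᵥ a) fresh × z ∈ sumset B A')
          disjoint (z∈ , z∈') with ∈-map⁻ (_+ᵥ a) z∈
          ... | b , b∈ , refl = proj₂ (∈-filter⁻ (¬? ∘ hit? a) {xs = B} b∈) (subst (_∈ W) (κ-+ b a) (old-hit z∈'))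

          unique : Unique (map (_+ᵥ a) fresh ++ sumset B A')
          unique = Unique.++⁺
            (Unique.map⁺ (λ {x} {y} → +ᵥ-cancelʳ a x y) (Unique.filter⁺ (¬? ∘ hit? a) uB))
            (sumset-unique B A') disjoint

          included : map (_+ᵥ a) fresh ++ sumset B A' ⊆ sumset B (a ∷ A')
          included z∈ with ∈-++⁻ (map (_+ᵥ a) fresh) z∈
          ... | inj₂ z∈' = sumset-mono {A = B} id there z∈'
          ... | inj₁ z∈' with ∈-map⁻ (_+ᵥ a) z∈'
          ...   | b , b∈ , refl = ∈-sumset⁺ (proj₁ (∈-filter⁻ (¬? ∘ hit? a) {xs = B} b∈)) (here refl)

          half : length B ≤ 2 * length fresh
          half = +-cancelˡ-≤ (length B) _ _ (begin
            length B + length B                  ≡⟨ cong (λ l → length B + l) (+-identityʳ (length B)) ⟨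
            2 * length B                         ≡⟨ cong (2 *_) (count+count-¬ (hit? a) B) ⟨
            2 * (count (hit? a) B + count (¬? ∘ hit? a) B) ≡⟨ 2[x+y]≡2x+2y (count (hit? a) B) _ ⟩
            2 * count (hit? a) B + 2 * count (¬? ∘ hit? a) B ≤⟨ +-monoˡ-≤ _ few ⟩
            length B + 2 * count (¬? ∘ hit? a) B ≡⟨ cong (λ l → length B + 2 * l) (length-filter≡count (¬? ∘ hit? a) B) ⟨
            length B + 2 * length fresh ∎)

    -- Take W to be all values `kB ⊕ κ a'` with a' chosen so far. It stays below half the size of R
    -- for n rounds, and each round adds |B| / 2 new sums.
    spread : ∀ {B R : List (Pt d)} {kB : List Y} → Unique B → (∀ {b} → b ∈ B → κ b ∈ kB) →
      Unique (map κ R) → 0 < length R → ∀ n → 2 * (n * length kB) ≤ length R →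
      ∃ λ A' → A' ⊆ R × length A' ≤ n × n * length B ≤ 2 * length (sumset B A')
    spread uB κB uR 0<R zero _ = [] , (λ ()) , z≤n , z≤n
    spread {B} {R} {kB} uB κB uR 0<R (suc n) big =
      let smaller = ≤-trans (*-monoʳ-≤ 2 (m≤n+m (n * length kB) (length kB))) big
          (A' , A'⊆R , |A'|≤n , ih) = spread uB κB uR 0<R n smaller
          (a , a∈R , few) = missing-translate (W A') {B} uR 0<R (≤-trans (|W|≤ A' |A'|≤n) smaller)
      in a ∷ A' , (λ { (here refl) → a∈R ; (there x∈) → A'⊆R x∈ }) , s≤s |A'|≤n ,
         ≤-trans (+-monoʳ-≤ (length B) ih) (gain (W A') a uB (old-hit A') few)
      where
      W : List (Pt d) → List Y
      W A' = cartesianProductWith _⊕_ kB (map κ A')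

      |W|≤ : ∀ A' → length A' ≤ n → 2 * length (W A') ≤ 2 * (n * length kB)
      |W|≤ A' |A'|≤n = *-monoʳ-≤ 2 (begin
        length (W A')                   ≡⟨ length-cartesianProductWith _⊕_ kB (map κ A') ⟩
        length kB * length (map κ A')   ≡⟨ cong (length kB *_) (length-map κ A') ⟩
        length kB * length A'           ≤⟨ *-monoʳ-≤ (length kB) |A'|≤n ⟩
        length kB * n                   ≡⟨ *-comm (length kB) n ⟩
        n * length kB ∎)
        where open ≤-Reasoning

      old-hit : ∀ A' {z} → z ∈ sumset B A' → κ z ∈ W A'
      old-hit A' z∈ with ∈-sumset⁻ B A' z∈
      ... | b , a' , b∈ , a'∈ , refl = subst (_∈ W A') (sym (κ-+ b a'))
        (∈-cartesianProductWith⁺ _⊕_ (κB b∈) (∈-map⁺ κ a'∈))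

  -- Along the walk x , x + v , … the quantity φ y · φ v increases, while it is bounded on S.

  module _ (φ : Pt d → ℤ) (φ-+ : ∀ x y → φ (x +ᵥ y) ≡ φ x ℤ.+ φ y) (v : Pt d) (φv≢0 : φ v ≢ 0ℤ) where

    last-before-exit : ∀ (S : List (Pt d)) (Q : Pt d → Set) → (∀ {x} → Q x → Q (x +ᵥ v)) →
      ∀ {x} → x ∈ S → Q x → ∃ λ y → y ∈ S × Q y × y +ᵥ v ∉ S
    last-before-exit S Q Q-step {x₀} x₀∈ Qx₀ = walk (suc (bound + ℤ.∣ ψ x₀ ∣)) x₀∈ Qx₀ start
      where
      -- The factor `φ v` turns each increment into the square of `φ v`, which is at least 1
      -- whatever the sign of `φ v`.
      ψ : Pt d → ℤ
      ψ y = φ y ℤ.* φ v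

      bound : ℕ
      bound = ∑ S (λ y → ℤ.∣ ψ y ∣)

      i≤+∣i∣ : ∀ i → i ℤ.≤ pos ℤ.∣ i ∣
      i≤+∣i∣ (pos n) = ℤ.≤-refl
      i≤+∣i∣ -[1+ n ] = ℤ.-≤+

      0≤i+∣i∣ : ∀ i → 0ℤ ℤ.≤ i ℤ.+ pos ℤ.∣ i ∣
      0≤i+∣i∣ (pos n) = ℤ.+≤+ z≤n
      0≤i+∣i∣ -[1+ n ] = ℤ.≤-reflexive (sym (ℤ.+-inverseˡ (pos (suc n))))

      ψ≤ : ∀ {y} → y ∈ S → ψ y ℤ.≤ pos bound
      ψ≤ {y} y∈ = ℤ.≤-trans (i≤+∣i∣ (ψ y)) (ℤ.+≤+ (∈⇒≤∑ (λ y → ℤ.∣ ψ y ∣) y∈))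

      square-pos : ∀ i → i ≢ 0ℤ → ℤ.1ℤ ℤ.≤ i ℤ.* i
      square-pos (pos zero) i≢0 = ⊥-elim (i≢0 refl)
      square-pos +[1+ n ] _ = ℤ.+≤+ (s≤s z≤n)
      square-pos -[1+ n ] _ = ℤ.+≤+ (s≤s z≤n)

      ψ-step : ∀ y → ψ y ℤ.+ ℤ.1ℤ ℤ.≤ ψ (y +ᵥ v)
      ψ-step y = begin
        ψ y ℤ.+ ℤ.1ℤ           ≤⟨ ℤ.+-monoʳ-≤ (ψ y) (square-pos (φ v) φv≢0) ⟩
        ψ y ℤ.+ φ v ℤ.* φ v    ≡⟨ ℤ.*-distribʳ-+ (φ v) (φ y) (φ v) ⟨
        (φ y ℤ.+ φ v) ℤ.* φ v  ≡⟨ cong (ℤ._* φ v) (φ-+ y v) ⟨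
        ψ (y +ᵥ v) ∎
        where open ℤ.≤-Reasoning

      start : pos bound ℤ.< ψ x₀ ℤ.+ pos (suc (bound + ℤ.∣ ψ x₀ ∣))
      start = begin-strict
        pos bound                                       <⟨ ℤ.+<+ (n<1+n bound) ⟩
        pos (suc bound)                                   ≤⟨ ℤ.+-monoˡ-≤ (pos (suc bound)) (0≤i+∣i∣ (ψ x₀)) ⟩
        ψ x₀ ℤ.+ pos ℤ.∣ ψ x₀ ∣ ℤ.+ pos (suc bound)          ≡⟨ ℤ.+-assoc (ψ x₀) _ _ ⟩
        ψ x₀ ℤ.+ pos (ℤ.∣ ψ x₀ ∣ + suc bound)            ≡⟨ cong (λ m → ψ x₀ ℤ.+ pos m) (+-comm ℤ.∣ ψ x₀ ∣ (suc bound)) ⟩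
        ψ x₀ ℤ.+ pos (suc (bound + ℤ.∣ ψ x₀ ∣)) ∎
        where open ℤ.≤-Reasoning

      walk : ∀ n {x} → x ∈ S → Q x → pos bound ℤ.< ψ x ℤ.+ pos n → ∃ λ y → y ∈ S × Q y × y +ᵥ v ∉ S
      walk zero x∈ Qx lt = ⊥-elim (ℤ.<⇒≱ (subst (pos bound ℤ.<_) (ℤ.+-identityʳ _) lt) (ψ≤ x∈))
      walk (suc n) {x} x∈ Qx lt with (x +ᵥ v) ∈ᵥ? S
      ... | no x+v∉ = x , x∈ , Qx , x+v∉
      ... | yes x+v∈ = walk n x+v∈ (Q-step Qx) (begin-strict
        pos bound                       <⟨ lt ⟩
        ψ x ℤ.+ (ℤ.1ℤ ℤ.+ pos n)       ≡⟨ ℤ.+-assoc (ψ x) ℤ.1ℤ (pos n) ⟨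
        ψ x ℤ.+ ℤ.1ℤ ℤ.+ pos n         ≤⟨ ℤ.+-monoˡ-≤ (pos n) (ψ-step x) ⟩
        ψ (x +ᵥ v) ℤ.+ pos n ∎)
        where open ℤ.≤-Reasoning

  -- Almost periods

  take-⊆ : ∀ n (xs : List X) → take n xs ⊆ xs
  take-⊆ (suc n) (x ∷ xs) (here refl) = here refl
  take-⊆ (suc n) (x ∷ xs) (there y∈) = there (take-⊆ n xs y∈)

  ^-distribʳ-* : ∀ m n o → (m * n) ^ o ≡ m ^ o * n ^ o
  ^-distribʳ-* m n zero = refl
  ^-distribʳ-* m n (suc o) = trans (cong (m * n *_) (^-distribʳ-* m n o)) (lem m n (m ^ o) (n ^ o))
    where
    lem : ∀ m n x y → m * n * (x * y) ≡ m * x * (n * y)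
    lem = solve-∀

  -- The leaves of the trees of depth i over A are the 2ⁱ-tuples of elements of A.

  Tree : Set → ℕ → Set
  Tree X zero = X
  Tree X (suc i) = Tree X i × Tree X i

  trees : List X → ∀ i → List (Tree X i)
  trees A zero = A
  trees A (suc i) = cartesianProduct (trees A i) (trees A i)

  leaves : ∀ i → Tree X i → List X
  leaves zero x = x ∷ []
  leaves (suc i) (s , t) = leaves i s ++ leaves i t

  tree-≡-dec : DecidableEquality X → ∀ i → DecidableEquality (Tree X i)
  tree-≡-dec _≟_ zero = _≟_
  tree-≡-dec _≟_ (suc i) = ×-≡-dec (tree-≡-dec _≟_ i) (tree-≡-dec _≟_ i)

  length-trees-suc : ∀ (A : List X) i → length (trees A (suc i)) ≡ length (trees A i) * length (trees A i)
  length-trees-suc A i = length-cartesianProductWith _,_ (trees A i) (trees A i)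

  length-trees : ∀ (A : List X) i → length (trees A i) ≡ length A ^ (2 ^ i)
  length-trees A zero = sym (*-identityʳ (length A))
  length-trees A (suc i) = begin
    length (trees A (suc i))                      ≡⟨ length-trees-suc A i ⟩
    length (trees A i) * length (trees A i)       ≡⟨ cong₂ _*_ (length-trees A i) (length-trees A i) ⟩
    length A ^ (2 ^ i) * length A ^ (2 ^ i)       ≡⟨ ^-distribˡ-+-* (length A) (2 ^ i) (2 ^ i) ⟨
    length A ^ (2 ^ i + 2 ^ i)                    ≡⟨ cong (λ k → length A ^ (2 ^ i + k)) (+-identityʳ (2 ^ i)) ⟨
    length A ^ (2 ^ suc i) ∎
    where open ≡-Reasoning

  trees-unique : ∀ {A : List X} → Unique A → ∀ i → Unique (trees A i)
  trees-unique u zero = u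
  trees-unique u (suc i) = Unique.cartesianProduct⁺ (trees-unique u i) (trees-unique u i)

  trees-nonempty : ∀ {A : List X} → 0 < length A → ∀ i → 0 < length (trees A i)
  trees-nonempty 0<A zero = 0<A
  trees-nonempty {A = A} 0<A (suc i) = subst (0 <_) (sym (length-trees-suc A i))
    (*-mono-≤ (trees-nonempty 0<A i) (trees-nonempty 0<A i))

  leaves-⊆ : ∀ {A : List X} i {t} → t ∈ trees A i → leaves i t ⊆ A
  leaves-⊆ zero t∈ (here refl) = t∈
  leaves-⊆ {A = A} (suc i) {s , t} st∈ x∈
    with ∈-cartesianProduct⁻ (trees A i) (trees A i) st∈ | ∈-++⁻ (leaves i s) x∈
  ... | s∈ , _ | inj₁ x∈s = leaves-⊆ i s∈ x∈s
  ... | _ , t∈ | inj₂ x∈t = leaves-⊆ i t∈ x∈t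

  length-leaves : ∀ i (t : Tree X i) → length (leaves i t) ≡ 2 ^ i
  length-leaves zero t = refl
  length-leaves (suc i) (s , t) = trans (length-++ (leaves i s))
    (cong₂ _+_ (length-leaves i s) (trans (length-leaves i t) (sym (+-identityʳ (2 ^ i)))))

  leaf : ∀ i (t : Tree X i) → ∃ λ x → x ∈ leaves i t
  leaf zero t = t , here refl
  leaf (suc i) (s , t) = let (x , x∈) = leaf i s in x , ∈-++⁺ˡ x∈

  tree-map : (X → Y) → ∀ i → Tree X i → Tree Y i
  tree-map f zero x = f x
  tree-map f (suc i) (s , t) = tree-map f i s , tree-map f i t

  tree-map-injective : ∀ {f : X → Y} → (∀ {x y} → f x ≡ f y → x ≡ y) →
    ∀ i {s t} → tree-map f i s ≡ tree-map f i t → s ≡ t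
  tree-map-injective inj zero eq = inj eq
  tree-map-injective inj (suc i) eq = cong₂ _,_
    (tree-map-injective inj i (cong proj₁ eq)) (tree-map-injective inj i (cong proj₂ eq))

  ∈-tree-map : ∀ {f : X → Y} {A B} → (∀ {a} → a ∈ A → f a ∈ B) → ∀ i {t} → t ∈ trees A i → tree-map f i t ∈ trees B i
  ∈-tree-map f∈ zero t∈ = f∈ t∈
  ∈-tree-map {A = A} f∈ (suc i) {s , t} st∈ =
    let (s∈ , t∈) = ∈-cartesianProduct⁻ (trees A i) (trees A i) st∈
    in ∈-cartesianProduct⁺ (∈-tree-map f∈ i s∈) (∈-tree-map f∈ i t∈)

  leaves-tree-map : ∀ (f : X → Y) i t → leaves i (tree-map f i t) ≡ map f (leaves i t)
  leaves-tree-map f zero t = refl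
  leaves-tree-map f (suc i) (s , t) = trans
    (cong₂ _++_ (leaves-tree-map f i s) (leaves-tree-map f i t))
    (sym (map-++ f (leaves i s) (leaves i t)))

  private
    near+near≤ : ∀ a e x y → e * x ≤ 4 * a → e * y ≤ 4 * a → e * (x + y) ≤ 8 * a
    near+near≤ a e x y p q = begin
      e * (x + y)     ≡⟨ *-distribˡ-+ e x y ⟩
      e * x + e * y   ≤⟨ +-mono-≤ p q ⟩
      4 * a + 4 * a   ≡⟨ lem a ⟩
      8 * a ∎
      where
      open ≤-Reasoning
      lem : ∀ a → 4 * a + 4 * a ≡ 8 * a
      lem = solve-∀

  -- By Markov's inequality, if D is small on average then some point is close to at least half of all points.

  central-point : ∀ (T : List X) (D : X → X → ℕ) e a → 0 < length T → 0 < a →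
    e * ∑ T (λ s → ∑ T (D s)) ≤ length T * (length T * a) →
    ∃ λ c → c ∈ T × length T ≤ 2 * length (filter (λ t → e * (D c t + D t c) ≤? 4 * a) T)
  central-point T D e a@(suc _) 0<T _ small =
    -- `D` is one-sided and both directions are needed later. Symmetrising doubles the mean, and
    -- Markov's inequality for half of the points doubles it again, hence `4 * a`.
    let (c , c∈ , c-small) = ∑-≤⇒∃≤ T {λ s → e * ∑ T (λ t → D s t + D t s)} {λ _ → 2 * (n * a)} 0<T avg
    in c , c∈ , half c c-small
    where
    open ≤-Reasoning
    n = length T

    lem₁ : ∀ e x n a → e * (x + x) ≡ 2 * (e * x)
    lem₁ = solve-∀
    lem₂ : ∀ n a → 2 * (n * (n * a)) ≡ n * (2 * (n * a))
    lem₂ = solve-∀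
    lem₃ : ∀ x a → 2 * x * (2 * a) ≡ x * (4 * a)
    lem₃ = solve-∀
    lem₄ : ∀ n a → 2 * (n * a) ≡ n * (2 * a)
    lem₄ = solve-∀
    lem₅ : ∀ g h → 2 * (g + h) ≡ 2 * h + 2 * g
    lem₅ = solve-∀

    avg : ∑ T (λ s → e * ∑ T (λ t → D s t + D t s)) ≤ ∑ T (λ _ → 2 * (n * a))
    avg = begin
      ∑ T (λ s → e * ∑ T (λ t → D s t + D t s))                     ≡⟨ *-distribˡ-∑ e T _ ⟨
      e * ∑ T (λ s → ∑ T (λ t → D s t + D t s))                     ≡⟨ cong (e *_) (∑-cong T (λ {s} _ → ∑-distrib-+ T (D s) (λ t → D t s))) ⟩
      e * ∑ T (λ s → ∑ T (D s) + ∑ T (λ t → D t s))                 ≡⟨ cong (e *_) (∑-distrib-+ T (λ s → ∑ T (D s)) (λ s → ∑ T (λ t → D t s))) ⟩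
      e * (∑ T (λ s → ∑ T (D s)) + ∑ T (λ s → ∑ T (λ t → D t s)))   ≡⟨ cong (λ x → e * (∑ T (λ s → ∑ T (D s)) + x)) (∑-comm T T (λ s t → D t s)) ⟩
      e * (∑ T (λ s → ∑ T (D s)) + ∑ T (λ t → ∑ T (D t)))           ≡⟨ lem₁ e (∑ T (λ s → ∑ T (D s))) n a ⟩
      2 * (e * ∑ T (λ s → ∑ T (D s)))                               ≤⟨ *-monoʳ-≤ 2 small ⟩
      2 * (n * (n * a))                                             ≡⟨ lem₂ n a ⟩
      n * (2 * (n * a))                                             ≡⟨ ∑-const T (2 * (n * a)) ⟨
      ∑ T (λ _ → 2 * (n * a)) ∎

    half : ∀ c → e * ∑ T (λ t → D c t + D t c) ≤ 2 * (n * a) →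
      n ≤ 2 * length (filter (λ t → e * (D c t + D t c) ≤? 4 * a) T)
    half c c-small = +-cancelˡ-≤ n _ _ (begin
      n + n                                ≡⟨ cong (λ x → n + x) (+-identityʳ n) ⟨
      2 * n                                ≡⟨ cong (2 *_) (count+count-¬ near? T) ⟨
      2 * (count near? T + count (¬? ∘ near?) T) ≡⟨ lem₅ (count near? T) _ ⟩
      2 * count (¬? ∘ near?) T + 2 * count near? T ≤⟨ +-monoˡ-≤ _ far ⟩
      n + 2 * count near? T                ≡⟨ cong (λ x → n + 2 * x) (length-filter≡count near? T) ⟨
      n + 2 * length (filter near? T) ∎)
      where
      near? = λ t → e * (D c t + D t c) ≤? 4 * a

      pointwise : ∀ {A : Set} (d : Dec A) x → (¬ A → 4 * a ≤ x) → 4 * a * ⟦ ¬? d ⟧ ≤ x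
      pointwise (yes _) x _ = ≤-trans (≤-reflexive (*-zeroʳ (4 * a))) z≤n
      pointwise (no ¬p) x f = ≤-trans (≤-reflexive (*-identityʳ (4 * a))) (f ¬p)

      far : 2 * count (¬? ∘ near?) T ≤ n
      far = *-cancelʳ-≤ _ n (2 * a) (begin
        2 * count (¬? ∘ near?) T * (2 * a)       ≡⟨ lem₃ (count (¬? ∘ near?) T) a ⟩
        count (¬? ∘ near?) T * (4 * a)           ≡⟨ *-comm _ (4 * a) ⟩
        4 * a * count (¬? ∘ near?) T             ≡⟨ *-distribˡ-∑ (4 * a) T _ ⟩
        ∑ T (λ t → 4 * a * ⟦ ¬? (near? t) ⟧)      ≤⟨ ∑-mono T (λ {t} _ → pointwise (near? t) (e * (D c t + D t c)) (<⇒≤ ∘ ≰⇒>)) ⟩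
        ∑ T (λ t → e * (D c t + D t c))          ≡⟨ *-distribˡ-∑ e T _ ⟨
        e * ∑ T (λ t → D c t + D t c)            ≤⟨ c-small ⟩
        2 * (n * a)                              ≡⟨ lem₄ n a ⟩
        n * (2 * a) ∎)

  -- Passing from 2ⁱ-tuples to 2ⁱ⁺¹-tuples, the average size of A + {tuple} increases; being bounded by C |A|, it
  -- is nearly stationary for some i ≤ C e, so that A + s and A + t nearly coincide for typical 2ⁱ-tuples s and t.

  module AlmostPeriods {d} (A : List (Pt d)) (uA : Unique A) (0<A : 0 < length A) (C e : ℕ) (1≤C : 1 ≤ C)
    (small-sumsets : ∀ {A'} → A' ⊆ A → length A' ≤ 2 ^ suc (C * e) + suc (2 * C ^ 2 ^ (C * e)) →
                     length (sumset A A') ≤ C * length A) where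

    -- If |A + shifts| ≤ C |A|, there are at most C ^ 2ⁱ times as many 2ⁱ-tuples over A + shifts as
    -- over A. Exceeding twice this factor leaves a collision even when only half of the tuples over
    -- A are typical.
    shift-count : ℕ
    shift-count = suc (2 * C ^ 2 ^ (C * e))

    -- Near invariance concerns a set S of the form A + {tuple} rather than A. What is used of S is
    -- that it contains a translate of A, so that every row of A forces an exit from S.
    AlmostPeriod : Set
    AlmostPeriod = ∃ λ v → v ≢ Vec.replicate d 0ℤ × ∃ λ S → ∃ λ a₀ → (∀ {x} → x ∈ A → x +ᵥ a₀ ∈ S) ×
      e * length (filter (λ z → ¬? (z ∈ᵥ? S)) (map (_+ᵥ v) S)) ≤ 8 * length A

    private
      a = length A
      T : ∀ i → List (Tree (Pt d) i)
      T = trees A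

      n : ℕ → ℕ
      n i = length (T i)

      tree-sum : ∀ i → Tree (Pt d) i → List (Pt d)
      tree-sum i t = sumset A (leaves i t)

      _∖_ : List (Pt d) → List (Pt d) → List (Pt d)
      U ∖ V = filter (λ z → ¬? (z ∈ᵥ? V)) U

      diff : ∀ i → Tree (Pt d) i → Tree (Pt d) i → ℕ
      diff i s t = length (tree-sum i t ∖ tree-sum i s)

      total-size total-diff : ℕ → ℕ
      total-size i = ∑ (T i) (λ t → length (tree-sum i t))
      total-diff i = ∑ (T i) (λ s → ∑ (T i) (diff i s))

      diff-unique : ∀ i s t → Unique (tree-sum i t ∖ tree-sum i s)
      diff-unique i s t = Unique.filter⁺ (λ z → ¬? (z ∈ᵥ? tree-sum i s)) (sumset-unique A (leaves i t))

      diff⁻ : ∀ U V {z} → z ∈ U ∖ V → z ∈ U × z ∉ V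
      diff⁻ U V z∈ = ∈-filter⁻ (λ z → ¬? (z ∈ᵥ? V)) {xs = U} z∈

      diff⁺ : ∀ {U V z} → z ∈ U → z ∉ V → z ∈ U ∖ V
      diff⁺ {V = V} z∈ z∉ = ∈-filter⁺ (λ z → ¬? (z ∈ᵥ? V)) z∈ z∉

      diff-triangle : ∀ i r s t → diff i r t ≤ diff i r s + diff i s t
      diff-triangle i r s t = begin
        diff i r t                                             ≤⟨ ⊆-length (diff-unique i r t) included ⟩
        length ((tree-sum i s ∖ tree-sum i r) ++ (tree-sum i t ∖ tree-sum i s)) ≡⟨ length-++ (tree-sum i s ∖ tree-sum i r) ⟩
        diff i r s + diff i s t ∎
        where
        open ≤-Reasoning
        included : (tree-sum i t ∖ tree-sum i r) ⊆ (tree-sum i s ∖ tree-sum i r) ++ (tree-sum i t ∖ tree-sum i s)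
        included {z} z∈ with diff⁻ (tree-sum i t) (tree-sum i r) z∈ | z ∈ᵥ? tree-sum i s
        ... | z∈t , z∉r | yes z∈s = ∈-++⁺ˡ (diff⁺ z∈s z∉r)
        ... | z∈t , z∉r | no z∉s = ∈-++⁺ʳ _ (diff⁺ z∈t z∉s)

      size-pair : ∀ i s t → length (tree-sum i s) + diff i s t ≤ length (tree-sum (suc i) (s , t))
      size-pair i s t = begin
        length (tree-sum i s) + diff i s t                         ≡⟨ length-++ (tree-sum i s) ⟨
        length (tree-sum i s ++ (tree-sum i t ∖ tree-sum i s))     ≤⟨ ⊆-length unique included ⟩
        length (tree-sum (suc i) (s , t)) ∎
        where
        open ≤-Reasoning
        unique : Unique (tree-sum i s ++ (tree-sum i t ∖ tree-sum i s))
        unique = Unique.++⁺ (sumset-unique A (leaves i s)) (diff-unique i s t)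
          (λ (z∈ , z∈') → proj₂ (diff⁻ (tree-sum i t) (tree-sum i s) z∈') z∈)
        included : tree-sum i s ++ (tree-sum i t ∖ tree-sum i s) ⊆ tree-sum (suc i) (s , t)
        included z∈ with ∈-++⁻ (tree-sum i s) z∈
        ... | inj₁ z∈s = sumset-mono {A = A} id ∈-++⁺ˡ z∈s
        ... | inj₂ z∈t = sumset-mono {A = A} id (∈-++⁺ʳ (leaves i s)) (proj₁ (diff⁻ (tree-sum i t) (tree-sum i s) z∈t))

      -- A + (s , t) is the union of A + s and A + t, so passing to pairs raises the mean size by at
      -- least the mean of `diff`.
      size-step : ∀ i → n i * total-size i + total-diff i ≤ total-size (suc i)
      size-step i = begin
        n i * total-size i + total-diff i
          ≡⟨ cong (_+ total-diff i) (*-distribˡ-∑ (n i) (T i) _) ⟩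
        ∑ (T i) (λ s → n i * length (tree-sum i s)) + total-diff i
          ≡⟨ cong (_+ total-diff i) (∑-cong (T i) (λ {s} _ → ∑-const (T i) (length (tree-sum i s)))) ⟨
        ∑ (T i) (λ s → ∑ (T i) (λ t → length (tree-sum i s))) + total-diff i
          ≡⟨ ∑-distrib-+ (T i) _ _ ⟨
        ∑ (T i) (λ s → ∑ (T i) (λ t → length (tree-sum i s)) + ∑ (T i) (diff i s))
          ≡⟨ ∑-cong (T i) (λ {s} _ → ∑-distrib-+ (T i) (λ _ → length (tree-sum i s)) (diff i s)) ⟨
        ∑ (T i) (λ s → ∑ (T i) (λ t → length (tree-sum i s) + diff i s t))
          ≤⟨ ∑-mono (T i) (λ {s} _ → ∑-mono (T i) (λ {t} _ → size-pair i s t)) ⟩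
        ∑ (T i) (λ s → ∑ (T i) (λ t → length (tree-sum (suc i) (s , t))))
          ≡⟨ ∑-cartesianProduct (T i) (T i) _ ⟨
        total-size (suc i) ∎
        where open ≤-Reasoning

      Stationary : ℕ → Set
      Stationary i = e * total-diff i ≤ n i * (n i * a)

      -- Each level that is not stationary raises the mean size of A + {tuple} by more than |A| / e;
      -- after j of them it is at least j |A| / e.
      search : ∀ j → (∃ λ i → i < j × Stationary i) ⊎ (j * (n j * a) ≤ e * total-size j)
      search zero = inj₂ z≤n
      search (suc j) with search j
      ... | inj₁ (i , i<j , st) = inj₁ (i , m<n⇒m<1+n i<j , st)
      ... | inj₂ large with e * total-diff j ≤? n j * (n j * a)
      ...   | yes st = inj₁ (j , n<1+n j , st)
      ...   | no ¬st = inj₂ (begin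
        suc j * (n (suc j) * a)               ≡⟨ cong (λ m → suc j * (m * a)) (length-trees-suc A j) ⟩
        suc j * (n j * n j * a)               ≡⟨ arith₁ j (n j) a ⟩
        n j * (j * (n j * a)) + n j * (n j * a) ≤⟨ +-mono-≤ (*-monoʳ-≤ (n j) large) (<⇒≤ (≰⇒> ¬st)) ⟩
        n j * (e * total-size j) + e * total-diff j ≡⟨ arith₂ (n j) e (total-size j) (total-diff j) ⟩
        e * (n j * total-size j + total-diff j) ≤⟨ *-monoʳ-≤ e (size-step j) ⟩
        e * total-size (suc j) ∎)
        where
        open ≤-Reasoning
        arith₁ : ∀ j m a → suc j * (m * m * a) ≡ m * (j * (m * a)) + m * (m * a)
        arith₁ = solve-∀
        arith₂ : ∀ m e s t → m * (e * s) + e * t ≡ e * (m * s + t)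
        arith₂ = solve-∀

      stationary : ∃ λ i → i ≤ C * e × Stationary i
      stationary with search (suc (C * e))
      ... | inj₁ (i , s≤s i≤ , st) = i , i≤ , st
      ... | inj₂ large = ⊥-elim (<⇒≱ too-small large)
        where
        open ≤-Reasoning
        j = suc (C * e)

        tree-size : ∀ {t} → t ∈ T j → length (tree-sum j t) ≤ C * a
        tree-size {t} t∈ = small-sumsets (leaves-⊆ j t∈) (≤-trans (≤-reflexive (length-leaves j t)) (m≤m+n _ _))

        arith : ∀ e m C a → e * (m * (C * a)) ≡ C * e * (m * a)
        arith = solve-∀

        too-small : e * total-size j < j * (n j * a)
        too-small = begin-strict
          e * total-size j          ≤⟨ *-monoʳ-≤ e (∑-mono (T j) tree-size) ⟩
          e * ∑ (T j) (λ _ → C * a) ≡⟨ cong (e *_) (∑-const (T j) (C * a)) ⟩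
          e * (n j * (C * a))       ≡⟨ arith e (n j) C a ⟩
          C * e * (n j * a)         <⟨ m<n+m _ (*-mono-≤ (trees-nonempty 0<A j) 0<A) ⟩
          j * (n j * a) ∎

      -- Two pairs (s , x) and (t , y) of a typical tuple and a shift collide, that is s + x ≡ t + y,
      -- because there are more such pairs than tuples of elements of A + shifts.
      collision : shift-count ≤ a → ∀ i → i ≤ C * e → ∀ {G} → Unique G → G ⊆ T i → n i ≤ 2 * length G →
        ∃ λ s → ∃ λ t → s ∈ G × t ∈ G × ∃ λ x → ∃ λ y → x ≢ y × tree-map (_+ᵥ x) i s ≡ tree-map (_+ᵥ y) i t
      collision M≤a i i≤ {G} uG G⊆ half =
        let ((s , x) , (t , y) , p∈ , q∈ , p≢q , eq) =
              pigeonhole (λ (s , x) → tree-map (_+ᵥ x) i s) (tree-≡-dec _≟ᵥ_ i)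
                (Unique.cartesianProduct⁺ uG (Unique.take⁺ shift-count uA)) into few
        in s , t , proj₁ (∈-cartesianProduct⁻ G shifts p∈) , proj₁ (∈-cartesianProduct⁻ G shifts q∈) ,
           x , y , distinct s t x y p≢q eq , eq
        where
        distinct : ∀ s t x y → (s , x) ≢ (t , y) → tree-map (_+ᵥ x) i s ≡ tree-map (_+ᵥ y) i t → x ≢ y
        distinct s t x .x p≢q eq refl = p≢q (cong (_, x) (tree-map-injective (λ {u} {w} → +ᵥ-cancelʳ x u w) i eq))

        shifts = take shift-count A
        S = sumset A shifts

        |shifts| : length shifts ≡ shift-count
        |shifts| = trans (length-take shift-count A) (m≤n⇒m⊓n≡m M≤a)

        |S|≤ : length S ≤ C * a
        |S|≤ = small-sumsets (take-⊆ shift-count A) (≤-trans (≤-reflexive |shifts|) (m≤n+m _ _))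

        into : ∀ {p} → p ∈ cartesianProduct G shifts → tree-map (_+ᵥ proj₂ p) i (proj₁ p) ∈ trees S i
        into p∈ = let (s∈ , x∈) = ∈-cartesianProduct⁻ G shifts p∈ in ∈-tree-map (λ a∈ → ∈-sumset⁺ a∈ x∈) i (G⊆ s∈)

        0<G : 0 < length G
        0<G = *-cancelˡ-< 2 0 _ (<-≤-trans (trees-nonempty 0<A i) half)

        few : length (trees S i) < length (cartesianProduct G shifts)
        few = begin-strict
          length (trees S i)                  ≡⟨ length-trees S i ⟩
          length S ^ 2 ^ i                    ≤⟨ ^-monoˡ-≤ (2 ^ i) |S|≤ ⟩
          (C * a) ^ 2 ^ i                     ≡⟨ ^-distribʳ-* C a (2 ^ i) ⟩
          C ^ 2 ^ i * a ^ 2 ^ i               ≡⟨ cong (C ^ 2 ^ i *_) (length-trees A i) ⟨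
          C ^ 2 ^ i * n i                     ≤⟨ *-mono-≤ (^-monoʳ-≤ C {{>-nonZero 1≤C}} (^-monoʳ-≤ 2 i≤)) half ⟩
          C ^ 2 ^ (C * e) * (2 * length G)    ≡⟨ arith (C ^ 2 ^ (C * e)) (length G) ⟩
          length G * (2 * C ^ 2 ^ (C * e))    <⟨ *-monoʳ-< (length G) {{>-nonZero 0<G}} (n<1+n _) ⟩
          length G * shift-count              ≡⟨ cong (length G *_) |shifts| ⟨
          length G * length shifts            ≡⟨ length-cartesianProductWith _,_ G shifts ⟨
          length (cartesianProduct G shifts) ∎
          where
          open ≤-Reasoning
          arith : ∀ c g → c * (2 * g) ≡ g * (2 * c)
          arith = solve-∀

      -- Every leaf l of s satisfies l + x = l' + y for some leaf l' of t. Hence translation by x -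
      -- y maps A + s into A + t, and the points leaving A + s are counted by `diff i s t`.
      translated : ∀ i s t x y → tree-map (_+ᵥ x) i s ≡ tree-map (_+ᵥ y) i t →
        ∀ {z} → z ∈ tree-sum i s → z +ᵥ (x -ᵥ y) ∈ tree-sum i t
      translated i s t x y eq z∈ with ∈-sumset⁻ A (leaves i s) z∈
      ... | b , l , b∈ , l∈ , refl
        with ∈-map⁻ (_+ᵥ y) (subst (l +ᵥ x ∈_) (trans (sym (leaves-tree-map (_+ᵥ x) i s)) (trans (cong (leaves i) eq) (leaves-tree-map (_+ᵥ y) i t))) (∈-map⁺ (_+ᵥ x) l∈))
      ... | l' , l'∈ , l+x≡l'+y = subst (_∈ tree-sum i t) (sym b+l+v≡) (∈-sumset⁺ b∈ l'∈)
        where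
        open ≡-Reasoning
        b+l+v≡ : (b +ᵥ l) +ᵥ (x -ᵥ y) ≡ b +ᵥ l'
        b+l+v≡ = +ᵥ-cancelʳ y _ _ (begin
          ((b +ᵥ l) +ᵥ (x -ᵥ y)) +ᵥ y  ≡⟨ +ᵥ-assoc (b +ᵥ l) (x -ᵥ y) y ⟩
          (b +ᵥ l) +ᵥ ((x -ᵥ y) +ᵥ y)  ≡⟨ cong ((b +ᵥ l) +ᵥ_) (x-y+y≡x x y) ⟩
          (b +ᵥ l) +ᵥ x                ≡⟨ +ᵥ-assoc b l x ⟩
          b +ᵥ (l +ᵥ x)                ≡⟨ cong (b +ᵥ_) l+x≡l'+y ⟩
          b +ᵥ (l' +ᵥ y)               ≡⟨ +ᵥ-assoc b l' y ⟨
          (b +ᵥ l') +ᵥ y ∎)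

      from-collision : ∀ i s t x y → tree-map (_+ᵥ x) i s ≡ tree-map (_+ᵥ y) i t →
        length (filter (λ z → ¬? (z ∈ᵥ? tree-sum i s)) (map (_+ᵥ (x -ᵥ y)) (tree-sum i s))) ≤ diff i s t
      from-collision i s t x y eq = ⊆-length
        (Unique.filter⁺ _ (Unique.map⁺ (λ {u} {w} → +ᵥ-cancelʳ (x -ᵥ y) u w) (sumset-unique A (leaves i s))))
        included
        where
        included : (map (_+ᵥ (x -ᵥ y)) (tree-sum i s) ∖ tree-sum i s) ⊆ (tree-sum i t ∖ tree-sum i s)
        included w∈ with diff⁻ (map (_+ᵥ (x -ᵥ y)) (tree-sum i s)) (tree-sum i s) w∈
        ... | w∈map , w∉ with ∈-map⁻ (_+ᵥ (x -ᵥ y)) w∈map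
        ... | z , z∈ , refl = diff⁺ (translated i s t x y eq z∈) w∉

      diffs : ∀ i → Tree (Pt d) i → Tree (Pt d) i → ℕ
      diffs i c t = e * (diff i c t + diff i t c)

      near? : ∀ i c t → Dec (diffs i c t ≤ 4 * a)
      near? i c t = diffs i c t ≤? 4 * a

      conclude : ∀ i c s t x y → diffs i c s ≤ 4 * a → diffs i c t ≤ 4 * a → x ≢ y →
        tree-map (_+ᵥ x) i s ≡ tree-map (_+ᵥ y) i t → AlmostPeriod
      conclude i c s t x y near-s near-t x≢y eq =
        x -ᵥ y , v≢0 , tree-sum i s , proj₁ (leaf i s) , (λ b∈ → ∈-sumset⁺ b∈ (proj₂ (leaf i s))) ,
        ≤-trans (*-monoʳ-≤ e (from-collision i s t x y eq)) (≤-trans (*-monoʳ-≤ e (diff-triangle i s c t))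
          (near+near≤ a e (diff i s c) (diff i c t)
            (≤-trans (*-monoʳ-≤ e (m≤n+m _ _)) near-s)
            (≤-trans (*-monoʳ-≤ e (m≤m+n _ _)) near-t)))
        where
        v≢0 : x -ᵥ y ≢ Vec.replicate d 0ℤ
        v≢0 v≡0 = x≢y (trans (sym (x-y+y≡x x y)) (trans (cong (_+ᵥ y) v≡0) (Vec.zipWith-identityˡ ℤ.+-identityˡ y)))

      from-stationary : shift-count ≤ a → ∀ i → i ≤ C * e → Stationary i → AlmostPeriod
      from-stationary M≤a i i≤ st =
        let (c , _ , half) = central-point (T i) (diff i) e a (trees-nonempty 0<A i) 0<A st
            (s , t , s∈ , t∈ , x , y , x≢y , eq) =
              collision M≤a i i≤ (Unique.filter⁺ (near? i c) (trees-unique uA i))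
                (λ s∈ → proj₁ (∈-filter⁻ (near? i c) {xs = T i} s∈)) half
        in conclude i c s t x y (proj₂ (∈-filter⁻ (near? i c) {xs = T i} s∈))
             (proj₂ (∈-filter⁻ (near? i c) {xs = T i} t∈)) x≢y eq

    almost-period : shift-count ≤ a → AlmostPeriod
    almost-period M≤a = let (i , i≤ , st) = stationary in from-stationary M≤a i i≤ st

  -- Linear functionals and projections

  ι : ℤ → ℚ
  ι z = z ℚ./ 1

  -- The normalisation in `z / 1` involves a gcd that does not compute for a variable z. This is the
  -- same number already in lowest terms, on which rational operations unfold.
  fromℤ : ℤ → ℚ
  fromℤ z = mkℚ z 0 (coprime-sym (1-coprimeTo ℤ.∣ z ∣))

  ι≡fromℤ : ∀ z → ι z ≡ fromℤ z
  ι≡fromℤ z = ℚ.↥p/↧p≡p (fromℤ z)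

  ι-+ : ∀ x y → ι (x ℤ.+ y) ≡ ι x ℚ.+ ι y
  ι-+ x y = sym (trans (cong₂ ℚ._+_ (ι≡fromℤ x) (ι≡fromℤ y))
    (cong ι (cong₂ ℤ._+_ (ℤ.*-identityʳ x) (ℤ.*-identityʳ y))))

  ι-* : ∀ x y → ι (x ℤ.* y) ≡ ι x ℚ.* ι y
  ι-* x y = sym (cong₂ ℚ._*_ (ι≡fromℤ x) (ι≡fromℤ y))

  ι-neg : ∀ x → ι (ℤ.- x) ≡ ℚ.- ι x
  ι-neg x = ℚ+.inverseˡ-unique (ι (ℤ.- x)) (ι x) (trans (sym (ι-+ (ℤ.- x) x)) (cong ι (ℤ.+-inverseˡ x)))

  ι-cancelʳ : ∀ z → z ≢ 0ℤ → ∀ p → p ℚ.* ι z ≡ 0ℚ → p ≡ 0ℚ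
  ι-cancelʳ z z≢0 p p*z≡0 = begin
    p                          ≡⟨ ℚ.*-identityʳ p ⟨
    p ℚ.* 1ℚ                   ≡⟨ cong (p ℚ.*_) (ℚ.*-inverseʳ (ι z)) ⟨
    p ℚ.* (ι z ℚ.* ℚ.1/ ι z)   ≡⟨ ℚ.*-assoc p (ι z) (ℚ.1/ ι z) ⟨
    p ℚ.* ι z ℚ.* ℚ.1/ ι z     ≡⟨ cong (ℚ._* ℚ.1/ ι z) p*z≡0 ⟩
    0ℚ ℚ.* ℚ.1/ ι z            ≡⟨ ℚ.*-zeroˡ (ℚ.1/ ι z) ⟩
    0ℚ ∎
    where
    open ≡-Reasoning
    instance
      ιz≢0 : ℚ.NonZero (ι z)
      ιz≢0 = ℚ.≢-nonZero (λ eq → z≢0 (ℚ.p≡0⇒↥p≡0 _ (trans (sym (ι≡fromℤ z)) eq)))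

  dotℚ-+ : ∀ (n : Vec ℚ d) x y → dotℚ n (x +ᵥ y) ≡ dotℚ n x ℚ.+ dotℚ n y
  dotℚ-+ [] [] [] = refl
  dotℚ-+ (c ∷ n) (a ∷ x) (b ∷ y) = begin
    c ℚ.* ι (a ℤ.+ b) ℚ.+ dotℚ n (x +ᵥ y)                       ≡⟨ cong₂ (λ u w → c ℚ.* u ℚ.+ w) (ι-+ a b) (dotℚ-+ n x y) ⟩
    c ℚ.* (ι a ℚ.+ ι b) ℚ.+ (dotℚ n x ℚ.+ dotℚ n y)             ≡⟨ solve 5 (λ c a b u w → c :* (a :+ b) :+ (u :+ w) := (c :* a :+ u) :+ (c :* b :+ w)) refl c (ι a) (ι b) _ _ ⟩
    (c ℚ.* ι a ℚ.+ dotℚ n x) ℚ.+ (c ℚ.* ι b ℚ.+ dotℚ n y) ∎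
    where
    open ≡-Reasoning
    open +-*-Solver

  0ᵥ≡replicate : ∀ d → 0ᵥ d ≡ replicate d 0ℚ
  0ᵥ≡replicate zero = refl
  0ᵥ≡replicate (suc d) = cong (0ℚ ∷_) (0ᵥ≡replicate d)

  -- An integral substitute for the quotient by the line of v: `π` names the line through a point,
  -- and `φ` tells apart the points of one line. `pullback` is the transpose of `π`, so it lifts
  -- parallel hyperplanes to parallel hyperplanes.
  record Projection (v : Pt (suc d)) : Set where
    field
      π : Pt (suc d) → Pt d
      φ : Pt (suc d) → ℤ
      π-+ : ∀ x y → π (x +ᵥ y) ≡ π x +ᵥ π y
      φ-+ : ∀ x y → φ (x +ᵥ y) ≡ φ x ℤ.+ φ y
      π-v : ∀ x → π (x +ᵥ v) ≡ π x
      φ-v : φ v ≢ 0ℤ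
      jointly-injective : ∀ x y → π x ≡ π y → φ x ≡ φ y → x ≡ y
      pullback : Vec ℚ d → Vec ℚ (suc d)
      dotℚ-pullback : ∀ n x → dotℚ (pullback n) x ≡ dotℚ n (π x)
      pullback≡0 : ∀ n → pullback n ≡ 0ᵥ (suc d) → n ≡ 0ᵥ d

  private
    -- The 2 × 2 minors of (x , y) and (z , w). They are z times the projection y - (x / z) w along
    -- (z , w), and so remain integral.
    minors : ℤ → ℤ → Pt d → Pt d → Pt d
    minors z x w y = zipWith (λ w y → z ℤ.* y ℤ.- x ℤ.* w) w y

    minors-+ : ∀ z x x' (w y y' : Pt d) → minors z (x ℤ.+ x') w (y +ᵥ y') ≡ minors z x w y +ᵥ minors z x' w y'
    minors-+ z x x' [] [] [] = refl
    minors-+ z x x' (w ∷ ws) (y ∷ ys) (y' ∷ ys') = cong₂ _∷_ (lem z x x' w y y') (minors-+ z x x' ws ys ys')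
      where
      lem : ∀ z x x' w y y' → z ℤ.* (y ℤ.+ y') ℤ.- (x ℤ.+ x') ℤ.* w ≡ (z ℤ.* y ℤ.- x ℤ.* w) ℤ.+ (z ℤ.* y' ℤ.- x' ℤ.* w)
      lem = solve-∀-ℤ

    minors-v : ∀ z x (w y : Pt d) → minors z (x ℤ.+ z) w (y +ᵥ w) ≡ minors z x w y
    minors-v z x [] [] = refl
    minors-v z x (w ∷ ws) (y ∷ ys) = cong₂ _∷_ (lem z x w y) (minors-v z x ws ys)
      where
      lem : ∀ z x w y → z ℤ.* (y ℤ.+ w) ℤ.- (x ℤ.+ z) ℤ.* w ≡ z ℤ.* y ℤ.- x ℤ.* w
      lem = solve-∀-ℤ

    minors-injective : ∀ z → z ≢ 0ℤ → ∀ x (w y y' : Pt d) → minors z x w y ≡ minors z x w y' → y ≡ y'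
    minors-injective z z≢0 x [] [] [] _ = refl
    minors-injective z z≢0 x (w ∷ ws) (y ∷ ys) (y' ∷ ys') eq = cong₂ _∷_
      (ℤ.*-cancelˡ-≡ z y y' {{ℤ.≢-nonZero z≢0}} (ℤ+.∙-cancelʳ (ℤ.- (x ℤ.* w)) _ _ (Vec.∷-injectiveˡ eq)))
      (minors-injective z z≢0 x ws ys ys' (Vec.∷-injectiveʳ eq))

    -- This is -(n · w), the coefficient of x in n · (z y - x w); `pull-tail` gives the coefficients
    -- of y.
    pull-head : Vec ℚ d → Pt d → ℚ
    pull-head [] [] = 0ℚ
    pull-head (c ∷ n) (w ∷ ws) = ℚ.- (c ℚ.* ι w) ℚ.+ pull-head n ws

    pull-tail : ℤ → Vec ℚ d → Vec ℚ d
    pull-tail z = Vec.map (ℚ._* ι z)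

    dotℚ-minors : ∀ z x (n : Vec ℚ d) w y →
      pull-head n w ℚ.* ι x ℚ.+ dotℚ (pull-tail z n) y ≡ dotℚ n (minors z x w y)
    dotℚ-minors z x [] [] [] = trans (ℚ.+-identityʳ _) (ℚ.*-zeroˡ (ι x))
    dotℚ-minors z x (c ∷ n) (w ∷ ws) (y ∷ ys) = begin
      (ℚ.- (c ℚ.* ι w) ℚ.+ pull-head n ws) ℚ.* ι x ℚ.+ (c ℚ.* ι z ℚ.* ι y ℚ.+ dotℚ (pull-tail z n) ys)
        ≡⟨ solve 7 (λ c w h x z y r →
             (:- (c :* w) :+ h) :* x :+ (c :* z :* y :+ r) := c :* (z :* y :+ :- (x :* w)) :+ (h :* x :+ r))
             refl c (ι w) (pull-head n ws) (ι x) (ι z) (ι y) (dotℚ (pull-tail z n) ys) ⟩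
      c ℚ.* (ι z ℚ.* ι y ℚ.+ ℚ.- (ι x ℚ.* ι w)) ℚ.+ (pull-head n ws ℚ.* ι x ℚ.+ dotℚ (pull-tail z n) ys)
        ≡⟨ cong₂ (λ u r → c ℚ.* u ℚ.+ r) (sym ι-minor) (dotℚ-minors z x n ws ys) ⟩
      c ℚ.* ι (z ℤ.* y ℤ.- x ℤ.* w) ℚ.+ dotℚ n (minors z x ws ys) ∎
      where
      open ≡-Reasoning
      open +-*-Solver
      ι-minor : ι (z ℤ.* y ℤ.- x ℤ.* w) ≡ ι z ℚ.* ι y ℚ.+ ℚ.- (ι x ℚ.* ι w)
      ι-minor = trans (ι-+ (z ℤ.* y) (ℤ.- (x ℤ.* w)))
        (cong₂ ℚ._+_ (ι-* z y) (trans (ι-neg (x ℤ.* w)) (cong ℚ.-_ (ι-* x w))))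

    pull-tail≡0 : ∀ z → z ≢ 0ℤ → ∀ (n : Vec ℚ d) → pull-tail z n ≡ 0ᵥ d → n ≡ 0ᵥ d
    pull-tail≡0 z z≢0 [] _ = refl
    pull-tail≡0 z z≢0 (c ∷ n) eq = cong₂ _∷_
      (ι-cancelʳ z z≢0 c (Vec.∷-injectiveˡ eq)) (pull-tail≡0 z z≢0 n (Vec.∷-injectiveʳ eq))

    head-pivot : ∀ z (w : Pt d) → z ≢ 0ℤ → Projection (z ∷ w)
    head-pivot z w z≢0 = record
      { π = λ { (x ∷ y) → minors z x w y }
      ; φ = Vec.head
      ; π-+ = λ { (x ∷ y) (x' ∷ y') → minors-+ z x x' w y y' }
      ; φ-+ = λ { (x ∷ y) (x' ∷ y') → refl }
      ; π-v = λ { (x ∷ y) → minors-v z x w y }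
      ; φ-v = z≢0
      ; jointly-injective = λ { (x ∷ y) (.x ∷ y') eq refl → cong (x ∷_) (minors-injective z z≢0 x w y y' eq) }
      ; pullback = λ n → pull-head n w ∷ pull-tail z n
      ; dotℚ-pullback = λ { n (x ∷ y) → dotℚ-minors z x n w y }
      ; pullback≡0 = λ n eq → pull-tail≡0 z z≢0 n (Vec.∷-injectiveʳ eq)
      }

    tail-pivot : ∀ {v : Pt (suc d)} → Projection v → Projection (0ℤ ∷ v)
    tail-pivot {v = v} P = record
      { π = λ { (x ∷ y) → x ∷ π y }
      ; φ = λ { (x ∷ y) → φ y }
      ; π-+ = λ { (x ∷ y) (x' ∷ y') → cong (x ℤ.+ x' ∷_) (π-+ y y') }
      ; φ-+ = λ { (x ∷ y) (x' ∷ y') → φ-+ y y' }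
      ; π-v = λ { (x ∷ y) → cong₂ _∷_ (ℤ.+-identityʳ x) (π-v y) }
      ; φ-v = φ-v
      ; jointly-injective = λ { (x ∷ y) (x' ∷ y') eq eq' →
          cong₂ _∷_ (Vec.∷-injectiveˡ eq) (jointly-injective y y' (Vec.∷-injectiveʳ eq) eq') }
      ; pullback = λ { (c ∷ n) → c ∷ pullback n }
      ; dotℚ-pullback = λ { (c ∷ n) (x ∷ y) → cong (c ℚ.* ι x ℚ.+_) (dotℚ-pullback n y) }
      ; pullback≡0 = λ { (c ∷ n) eq → cong₂ _∷_ (Vec.∷-injectiveˡ eq) (pullback≡0 n (Vec.∷-injectiveʳ eq)) }
      }
      where open Projection P

  project-along : ∀ (v : Pt (suc d)) → v ≢ replicate (suc d) 0ℤ → Projection v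
  project-along (z ∷ w) v≢0 with z ℤ.≟ 0ℤ
  project-along (z ∷ w) v≢0 | no z≢0 = head-pivot z w z≢0
  project-along {zero} (z ∷ []) v≢0 | yes refl = ⊥-elim (v≢0 refl)
  project-along {suc d} (z ∷ w) v≢0 | yes refl = tail-pivot (project-along w (v≢0 ∘ cong (0ℤ ∷_)))

  -- Sets meeting more than t hyperplanes of every parallel class

  module Values {d} (n : Vec ℚ d) where
    open Fibres ℚ._≟_ (dotℚ n) public

  -- A positive form of the hypothesis on A. The number of values of a functional is what has to be
  -- compared with the number of values on a part of A.
  Spread : ℕ → List (Pt d) → Set
  Spread {d} t A = ∀ n → n ≢ 0ᵥ d → t < length (Values.keys n A)

  pad : ∀ t (ks : List ℚ) → length ks ≤ t → Σ (Vec ℚ t) λ c → ∀ {k} → k ∈ ks → ∃ λ i → k ≡ Vec.lookup c i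
  -- Exactly t constants are required; the surplus ones are set to 0, since additional hyperplanes
  -- do no harm.
  pad t [] _ = replicate t 0ℚ , λ ()
  pad (suc t) (k ∷ ks) (s≤s |ks|≤t) = let (c , ks⊆c) = pad t ks |ks|≤t in
    k ∷ c , λ { (here refl) → zero , refl ; (there k∈) → let (i , eq) = ks⊆c k∈ in suc i , eq }

  spread-intro : ∀ {t} {A : List (Pt d)} → ¬ InParallelHyperplanes t A → Spread t A
  spread-intro {t = t} {A} ¬covered n n≢0 with t <? length (Values.keys n A)
  ... | yes t< = t<
  ... | no t≮ = let (c , keys⊆c) = pad t (Values.keys n A) (≮⇒≥ t≮) in
    ⊥-elim (¬covered (n , n≢0 , c , λ a a∈ → keys⊆c (Values.∈-keys n a∈)))

  -- Three translates of a set of integers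

  private
    ∣pos-pos∣< : ∀ {D} m n → m < D → n < D → ℤ.∣ pos m ℤ.- pos n ∣ < D
    ∣pos-pos∣< m n m<D n<D rewrite ℤ.m-n≡m⊖n m n with ≤-total n m
    ... | inj₁ n≤m rewrite ℤ.⊖-≥ n≤m = ≤-<-trans (m∸n≤m m n) m<D
    ... | inj₂ m≤n rewrite ℤ.∣m⊖n∣≡∣n⊖m∣ m n | ℤ.⊖-≥ m≤n = ≤-<-trans (m∸n≤m n m) n<D

    small-multiple : ∀ {D} m n k → m < D → n < D → pos m ℤ.- pos n ≡ k ℤ.* pos D → m ≡ n
    small-multiple {D} m n k m<D n<D eq = helper ℤ.∣ k ∣ refl
      where
      open ≤-Reasoning
      helper : ∀ q → ℤ.∣ k ∣ ≡ q → m ≡ n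
      helper zero ∣k∣≡ = ℤ.+-injective (ℤ.i-j≡0⇒i≡j (pos m) (pos n) (trans eq
        (trans (cong (ℤ._* pos D) (ℤ.∣i∣≡0⇒i≡0 {k} ∣k∣≡)) (ℤ.*-zeroˡ (pos D)))))
      helper (suc q) ∣k∣≡ = ⊥-elim (<⇒≱ (∣pos-pos∣< m n m<D n<D) (begin
        D                            ≤⟨ m≤m+n D (q * D) ⟩
        suc q * D                    ≡⟨ cong (_* D) ∣k∣≡ ⟨
        ℤ.∣ k ∣ * D                  ≡⟨ ℤ.abs-* k (pos D) ⟨
        ℤ.∣ k ℤ.* pos D ∣            ≡⟨ cong ℤ.∣_∣ eq ⟨
        ℤ.∣ pos m ℤ.- pos n ∣ ∎))

    %ℕ-+ : ∀ i D .{{_ : NonZero D}} → (i ℤ.+ pos D) %ℕ D ≡ i %ℕ D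
    %ℕ-+ i D = small-multiple _ _ ((i /ℕ D) ℤ.+ ℤ.1ℤ ℤ.- (i ℤ.+ pos D) /ℕ D) (n%ℕd<d (i ℤ.+ pos D) D) (n%ℕd<d i D)
      (begin
        r' ℤ.- r                                                  ≡⟨ lem r' q' r (pos D) ⟩
        (r' ℤ.+ q' ℤ.* pos D) ℤ.- q' ℤ.* pos D ℤ.- r             ≡⟨ cong (λ x → x ℤ.- q' ℤ.* pos D ℤ.- r) (a≡a%ℕn+[a/ℕn]*n (i ℤ.+ pos D) D) ⟨
        (i ℤ.+ pos D) ℤ.- q' ℤ.* pos D ℤ.- r                     ≡⟨ cong (λ x → x ℤ.+ pos D ℤ.- q' ℤ.* pos D ℤ.- r) (a≡a%ℕn+[a/ℕn]*n i D) ⟩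
        (r ℤ.+ q ℤ.* pos D ℤ.+ pos D) ℤ.- q' ℤ.* pos D ℤ.- r     ≡⟨ lem₂ r q q' (pos D) ⟩
        (q ℤ.+ ℤ.1ℤ ℤ.- q') ℤ.* pos D ∎)
      where
      open ≡-Reasoning
      r = pos (i %ℕ D)
      q = i /ℕ D
      r' = pos ((i ℤ.+ pos D) %ℕ D)
      q' = (i ℤ.+ pos D) /ℕ D
      lem : ∀ r' q' r D → r' ℤ.- r ≡ (r' ℤ.+ q' ℤ.* D) ℤ.- q' ℤ.* D ℤ.- r
      lem = solve-∀-ℤ
      lem₂ : ∀ r q q' D → (r ℤ.+ q ℤ.* D ℤ.+ D) ℤ.- q' ℤ.* D ℤ.- r ≡ (q ℤ.+ ℤ.1ℤ ℤ.- q') ℤ.* D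
      lem₂ = solve-∀-ℤ

    %ℕ-injective : ∀ i D .{{_ : NonZero D}} {m n} → m < D → n < D →
      (i ℤ.+ pos m) %ℕ D ≡ (i ℤ.+ pos n) %ℕ D → m ≡ n
    %ℕ-injective i D {m} {n} m<D n<D eq = small-multiple m n (q ℤ.- q') m<D n<D (begin
      pos m ℤ.- pos n                                  ≡⟨ lem i (pos m) (pos n) ⟩
      (i ℤ.+ pos m) ℤ.- (i ℤ.+ pos n)                  ≡⟨ cong₂ ℤ._-_ (a≡a%ℕn+[a/ℕn]*n (i ℤ.+ pos m) D) (a≡a%ℕn+[a/ℕn]*n (i ℤ.+ pos n) D) ⟩
      (pos ((i ℤ.+ pos m) %ℕ D) ℤ.+ q ℤ.* pos D) ℤ.- (r ℤ.+ q' ℤ.* pos D) ≡⟨ cong (λ x → (pos x ℤ.+ q ℤ.* pos D) ℤ.- (r ℤ.+ q' ℤ.* pos D)) eq ⟩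
      (r ℤ.+ q ℤ.* pos D) ℤ.- (r ℤ.+ q' ℤ.* pos D)     ≡⟨ lem₂ r q q' (pos D) ⟩
      (q ℤ.- q') ℤ.* pos D ∎)
      where
      open ≡-Reasoning
      q = (i ℤ.+ pos m) /ℕ D
      q' = (i ℤ.+ pos n) /ℕ D
      r = pos ((i ℤ.+ pos n) %ℕ D)
      lem : ∀ i m n → m ℤ.- n ≡ (i ℤ.+ m) ℤ.- (i ℤ.+ n)
      lem = solve-∀-ℤ
      lem₂ : ∀ r q q' D → (r ℤ.+ q ℤ.* D) ℤ.- (r ℤ.+ q' ℤ.* D) ≡ (q ℤ.- q') ℤ.* D
      lem₂ = solve-∀-ℤ

    i+[j-i]≡j : ∀ i j → i ℤ.+ (j ℤ.- i) ≡ j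
    i+[j-i]≡j = solve-∀-ℤ

  minimum : (f : X → ℤ) → ∀ xs → 0 < length xs → ∃ λ lo → lo ∈ xs × (∀ {x} → x ∈ xs → f lo ℤ.≤ f x)
  minimum f (x ∷ xs) _ = argmin f x xs , [ here , there ]′ (argmin-sel f x xs) ,
    λ { (here refl) → f[argmin]≤f[⊤] {f = f} x xs ; (there y∈) → All.lookup (f[argmin]≤f[xs] {f = f} x xs) y∈ }

  maximum : (f : X → ℤ) → ∀ xs → 0 < length xs → ∃ λ hi → hi ∈ xs × (∀ {x} → x ∈ xs → f x ℤ.≤ f hi)
  maximum f (x ∷ xs) _ = argmax f x xs , [ here , there ]′ (argmax-sel f x xs) ,
    λ { (here refl) → f[⊥]≤f[argmax] {f = f} x xs ; (there y∈) → All.lookup (f[xs]≤f[argmax] {f = f} x xs) y∈ }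

  module ThreeTranslates {d} (φ : Pt d → ℤ) (φ-+ : ∀ x y → φ (x +ᵥ y) ≡ φ x ℤ.+ φ y) where

    ≤-offset : ∀ {i j} → i ℤ.≤ j → j ≡ i ℤ.+ pos ℤ.∣ j ℤ.- i ∣
    ≤-offset {i} {j} i≤j = trans (sym (i+[j-i]≡j i j)) (cong (λ x → i ℤ.+ x) (sym (ℤ.0≤i⇒+∣i∣≡i (ℤ.i≤j⇒0≤j-i i≤j))))

    module Extremes (B : List (Pt d)) (lo hi : Pt d) (lo∈ : lo ∈ B) (hi∈ : hi ∈ B) (lo≢hi : lo ≢ hi)
      (lo≤ : ∀ {b} → b ∈ B → φ lo ℤ.≤ φ b) (≤hi : ∀ {b} → b ∈ B → φ b ℤ.≤ φ hi)
      (uB : Unique B) (φ-inj : ∀ {b b'} → b ∈ B → b' ∈ B → φ b ≡ φ b' → b ≡ b') where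

      offset : Pt d → ℕ
      offset b = ℤ.∣ φ b ℤ.- φ lo ∣

      D : ℕ
      D = offset hi

      v : Pt d
      v = hi -ᵥ lo

      φ-offset : ∀ {b} → b ∈ B → φ b ≡ φ lo ℤ.+ pos (offset b)
      φ-offset b∈ = ≤-offset (lo≤ b∈)

      pos-offset : ∀ {b} → b ∈ B → pos (offset b) ≡ φ b ℤ.- φ lo
      pos-offset b∈ = ℤ.0≤i⇒+∣i∣≡i (ℤ.i≤j⇒0≤j-i (lo≤ b∈))

      instance
        D≢0 : NonZero D
        D≢0 = ≢-nonZero (λ D≡0 → lo≢hi (φ-inj lo∈ hi∈ (sym (trans (φ-offset hi∈)
          (trans (cong (λ m → φ lo ℤ.+ pos m) D≡0) (ℤ.+-identityʳ (φ lo)))))))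

      φv≡D : φ v ≡ pos D
      φv≡D = lem (φ v) (φ lo) (pos D) (trans (sym (φ-+ v lo)) (trans (cong φ (x-y+y≡x hi lo)) (φ-offset hi∈)))
        where
        lem : ∀ x l D → x ℤ.+ l ≡ l ℤ.+ D → x ≡ D
        lem x l D eq = ℤ+.∙-cancelˡ l x D (trans (ℤ.+-comm l x) eq)

      φv≢0 : φ v ≢ 0ℤ
      φv≢0 eq = ℕ.≢-nonZero⁻¹ D (ℤ.+-injective (trans (sym φv≡D) eq))

      class : Pt d → ℕ
      class z = φ z %ℕ D

      class-v : ∀ z → class (z +ᵥ v) ≡ class z
      class-v z = trans (cong (_%ℕ D) (trans (φ-+ z v) (cong (λ x → φ z ℤ.+ x) φv≡D))) (%ℕ-+ (φ z) D)

      -- `hi` is removed because it has the residue of `lo` modulo D; the offsets of all other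
      -- elements lie below D and are distinct residues.
      B⁻ : List (Pt d)
      B⁻ = filter (λ b → ¬? (b ≟ᵥ hi)) B

      B⁻⊆ : B⁻ ⊆ B
      B⁻⊆ b∈ = proj₁ (∈-filter⁻ (λ b → ¬? (b ≟ᵥ hi)) {xs = B} b∈)

      |B|≤ : length B ≤ suc (length B⁻)
      |B|≤ = ⊆-length uB B⊆
        where
        B⊆ : B ⊆ hi ∷ B⁻
        B⊆ {b} b∈ with b ≟ᵥ hi
        ... | yes refl = here refl
        ... | no b≢hi = there (∈-filter⁺ (λ b → ¬? (b ≟ᵥ hi)) b∈ b≢hi)

      offset<D : ∀ {b} → b ∈ B⁻ → offset b < D
      offset<D {b} b∈ = ≤∧≢⇒< (ℤ.drop‿+≤+ (ℤ.≤-trans (ℤ.≤-reflexive (pos-offset (B⁻⊆ b∈)))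
          (ℤ.≤-trans (ℤ.+-monoˡ-≤ (ℤ.- φ lo) (≤hi (B⁻⊆ b∈))) (ℤ.≤-reflexive (sym (pos-offset hi∈))))))
        (λ eq → proj₂ (∈-filter⁻ (λ b → ¬? (b ≟ᵥ hi)) {xs = B} b∈)
          (φ-inj (B⁻⊆ b∈) hi∈ (trans (φ-offset (B⁻⊆ b∈)) (trans (cong (λ m → φ lo ℤ.+ pos m) eq) (sym (φ-offset hi∈))))))

      class-injective : ∀ x {b b'} → b ∈ B⁻ → b' ∈ B⁻ → class (x +ᵥ b) ≡ class (x +ᵥ b') → b ≡ b'
      class-injective x {b} {b'} b∈ b'∈ eq = φ-inj (B⁻⊆ b∈) (B⁻⊆ b'∈)
        (trans (φ-offset (B⁻⊆ b∈)) (trans (cong (λ m → φ lo ℤ.+ pos m) offsets≡) (sym (φ-offset (B⁻⊆ b'∈)))))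
        where
        φ-sum : ∀ {b} → b ∈ B⁻ → φ (x +ᵥ b) ≡ (φ x ℤ.+ φ lo) ℤ.+ pos (offset b)
        φ-sum {b} b∈ = trans (φ-+ x b) (trans (cong (λ y → φ x ℤ.+ y) (φ-offset (B⁻⊆ b∈))) (sym (ℤ.+-assoc (φ x) (φ lo) _)))
        offsets≡ : offset b ≡ offset b'
        offsets≡ = %ℕ-injective (φ x ℤ.+ φ lo) D (offset<D b∈) (offset<D b'∈)
          (trans (cong (_%ℕ D) (sym (φ-sum b∈))) (trans eq (cong (_%ℕ D) (φ-sum b'∈))))

      translates : List (Pt d) → Pt d → List (Pt d)
      translates X b = sumset X (lo ∷ b ∷ hi ∷ [])

      module _ (X : List (Pt d)) (uX : Unique X) where

        open Fibres ℕ._≟_ class using (keys; keys-unique; ∈-keys; ∈-keys⁻)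
        open import Data.List.Membership.DecPropositional ℕ._≟_ using (_∈?_)

        private
          S : List (Pt d)
          S = map (_+ᵥ lo) X

          classes : List ℕ
          classes = keys S

          exits : List (Pt d)
          exits = filter (λ z → ¬? (z ∈ᵥ? S)) (map (_+ᵥ v) S)

          old? : ∀ z → Dec (class z ∈ classes)
          old? z = class z ∈? classes

          new : Pt d → List (Pt d)
          new b = filter (¬? ∘ old?) (map (_+ᵥ b) X)

          S-unique : ∀ b → Unique (map (_+ᵥ b) X)
          S-unique b = Unique.map⁺ (λ {x} {y} → +ᵥ-cancelʳ b x y) uX

          exits⁻ : ∀ {z} → z ∈ exits → z ∈ map (_+ᵥ v) S × z ∉ S
          exits⁻ = ∈-filter⁻ (λ z → ¬? (z ∈ᵥ? S)) {xs = map (_+ᵥ v) S}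

          -- S + v is X + hi. Within each residue class the walk by v has to leave S, and its first
          -- point outside S belongs to X + hi but not to X + lo.
          classes≤exits : length classes ≤ length exits
          classes≤exits = subst (length classes ≤_) (length-map class exits) (⊆-length (keys-unique S) included)
            where
            included : classes ⊆ map class exits
            included {k} k∈ =
              let (z , z∈ , k≡) = ∈-keys⁻ {S} k∈
                  (y , y∈ , cy≡ , y+v∉) = last-before-exit φ φ-+ v φv≢0 S (λ y → class y ≡ class z)
                                             (λ {y} eq → trans (class-v y) eq) z∈ refl
              in subst (_∈ map class exits) (trans (class-v y) (trans cy≡ (sym k≡)))
                   (∈-map⁺ class (∈-filter⁺ (λ z → ¬? (z ∈ᵥ? S)) (∈-map⁺ (_+ᵥ v) y∈) y+v∉))

          count-translates : ∀ b → length X + length classes + length (new b) ≤ length (translates X b)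
          count-translates b = begin
            length X + length classes + length (new b)     ≤⟨ +-monoˡ-≤ (length (new b)) (+-monoʳ-≤ (length X) classes≤exits) ⟩
            length X + length exits + length (new b)       ≡⟨ cong (λ l → l + length exits + length (new b)) (length-map (_+ᵥ lo) X) ⟨
            length S + length exits + length (new b)       ≡⟨ cong (_+ length (new b)) (length-++ S) ⟨
            length (S ++ exits) + length (new b)           ≡⟨ length-++ (S ++ exits) ⟨
            length ((S ++ exits) ++ new b)                 ≤⟨ ⊆-length unique included ⟩
            length (translates X b) ∎
            where
            open ≤-Reasoning
            old-class : ∀ {z} → z ∈ S ++ exits → class z ∈ classes
            old-class z∈ = [ ∈-keys , exit-class ]′ (∈-++⁻ S z∈)
              where
              exit-class : ∀ {z} → z ∈ exits → class z ∈ classes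
              exit-class z∈ = let (y , y∈ , z≡) = ∈-map⁻ (_+ᵥ v) (proj₁ (exits⁻ z∈)) in
                subst (_∈ classes) (sym (trans (cong class z≡) (class-v y))) (∈-keys y∈)

            unique : Unique ((S ++ exits) ++ new b)
            unique = Unique.++⁺
              (Unique.++⁺ (S-unique lo)
                (Unique.filter⁺ (λ z → ¬? (z ∈ᵥ? S)) (Unique.map⁺ (λ {x} {y} → +ᵥ-cancelʳ v x y) (S-unique lo)))
                (λ (z∈ , z∈') → proj₂ (exits⁻ z∈') z∈))
              (Unique.filter⁺ (¬? ∘ old?) (S-unique b))
              (λ (z∈ , z∈') → proj₂ (∈-filter⁻ (¬? ∘ old?) {xs = map (_+ᵥ b) X} z∈') (old-class z∈))

            translate-in : ∀ {c} → c ∈ lo ∷ b ∷ hi ∷ [] → ∀ {z} → z ∈ map (_+ᵥ c) X → z ∈ translates X b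
            translate-in {c} c∈ z∈ = let (x , x∈ , z≡) = ∈-map⁻ (_+ᵥ c) z∈ in
              subst (_∈ translates X b) (sym z≡) (∈-sumset⁺ x∈ c∈)

            exit-in : ∀ {z} → z ∈ exits → z ∈ translates X b
            exit-in z∈ =
              let (y , y∈ , z≡) = ∈-map⁻ (_+ᵥ v) (proj₁ (exits⁻ z∈))
                  (x , x∈ , y≡) = ∈-map⁻ (_+ᵥ lo) y∈
              in subst (_∈ translates X b)
                   (sym (trans z≡ (trans (cong (_+ᵥ v) y≡)
                     (trans (+ᵥ-assoc x lo v) (cong (x +ᵥ_) (trans (+ᵥ-comm lo v) (x-y+y≡x hi lo)))))))
                   (∈-sumset⁺ x∈ (there (there (here refl))))

            included : (S ++ exits) ++ new b ⊆ translates X b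
            included z∈ = [ [ translate-in (here refl) , exit-in ]′ ∘ ∈-++⁻ S
                          , translate-in (there (here refl)) ∘ proj₁ ∘ ∈-filter⁻ (¬? ∘ old?) {xs = map (_+ᵥ b) X}
                          ]′ (∈-++⁻ (S ++ exits) z∈)

          τ = length B⁻
          q = length classes

          -- For fixed x the sums x + b have distinct residues, so all but at most q of the b carry
          -- x into a class that X + lo does not meet.
          few-old : ∀ x → count (λ b → old? (x +ᵥ b)) B⁻ ≤ q
          few-old x = begin
            count (λ b → old? (x +ᵥ b)) B⁻             ≡⟨ length-filter≡count (λ b → old? (x +ᵥ b)) B⁻ ⟨
            length (filter (λ b → old? (x +ᵥ b)) B⁻)   ≤⟨ injection-length (λ b → class (x +ᵥ b))
              (Unique.filter⁺ _ (Unique.filter⁺ _ uB))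
              (λ b∈ b'∈ → class-injective x (inB⁻ b∈) (inB⁻ b'∈))
              (λ b∈ → proj₂ (∈-filter⁻ (λ b → old? (x +ᵥ b)) {xs = B⁻} b∈)) ⟩
            q ∎
            where
            open ≤-Reasoning
            inB⁻ : ∀ {b} → b ∈ filter (λ b → old? (x +ᵥ b)) B⁻ → b ∈ B⁻
            inB⁻ b∈ = proj₁ (∈-filter⁻ (λ b → old? (x +ᵥ b)) {xs = B⁻} b∈)

          many-new : length X * τ ≤ length X * q + ∑ B⁻ (λ b → length (new b))
          many-new = begin
            length X * τ
              ≡⟨ ∑-const X τ ⟨
            ∑ X (λ x → τ)
              ≡⟨ ∑-cong X (λ {x} _ → count+count-¬ (λ b → old? (x +ᵥ b)) B⁻) ⟨
            ∑ X (λ x → count (λ b → old? (x +ᵥ b)) B⁻ + count (λ b → ¬? (old? (x +ᵥ b))) B⁻)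
              ≤⟨ ∑-mono X (λ {x} _ → +-monoˡ-≤ _ (few-old x)) ⟩
            ∑ X (λ x → q + count (λ b → ¬? (old? (x +ᵥ b))) B⁻)
              ≡⟨ ∑-distrib-+ X (λ _ → q) (λ x → count (λ b → ¬? (old? (x +ᵥ b))) B⁻) ⟩
            ∑ X (λ _ → q) + ∑ X (λ x → count (λ b → ¬? (old? (x +ᵥ b))) B⁻)
              ≡⟨ cong₂ _+_ (∑-const X q) (∑-comm X B⁻ (λ x b → ⟦ ¬? (old? (x +ᵥ b)) ⟧)) ⟩
            length X * q + ∑ B⁻ (λ b → ∑ X (λ x → ⟦ ¬? (old? (x +ᵥ b)) ⟧))
              ≡⟨ cong (length X * q +_) (∑-cong B⁻ (λ {b} _ → ∑-map (_+ᵥ b) X (λ z → ⟦ ¬? (old? z) ⟧))) ⟨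
            length X * q + ∑ B⁻ (λ b → count (¬? ∘ old?) (map (_+ᵥ b) X))
              ≡⟨ cong (length X * q +_) (∑-cong B⁻ (λ {b} _ → length-filter≡count (¬? ∘ old?) (map (_+ᵥ b) X))) ⟨
            length X * q + ∑ B⁻ (λ b → length (new b)) ∎
            where open ≤-Reasoning

          total : τ * (length X + q) + ∑ B⁻ (λ b → length (new b)) ≤ ∑ B⁻ (λ b → length (translates X b))
          total = begin
            τ * (length X + q) + ∑ B⁻ (λ b → length (new b))
              ≡⟨ cong (_+ ∑ B⁻ (λ b → length (new b))) (∑-const B⁻ (length X + q)) ⟨
            ∑ B⁻ (λ _ → length X + q) + ∑ B⁻ (λ b → length (new b))
              ≡⟨ ∑-distrib-+ B⁻ (λ _ → length X + q) (λ b → length (new b)) ⟨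
            ∑ B⁻ (λ b → length X + q + length (new b))
              ≤⟨ ∑-mono B⁻ (λ {b} _ → count-translates b) ⟩
            ∑ B⁻ (λ b → length (translates X b)) ∎
            where open ≤-Reasoning

          -- If q is at least τ, the exits alone supply τ extra points. Otherwise the points in new
          -- classes number at least α (τ - q) in total, hence at least τ (τ - q), which makes up
          -- for the shortfall.
          arith : ∀ τ α q N S → τ ≤ α → α * τ ≤ α * q + N → τ * (α + q) + N ≤ S → τ * (α + τ) ≤ S
          arith τ α q N S τ≤α new≤ total≤ with ≤-total τ q
          ... | inj₁ τ≤q = ≤-trans (*-monoʳ-≤ τ (+-monoʳ-≤ α τ≤q)) (≤-trans (m≤m+n _ N) total≤)
          ... | inj₂ q≤τ = ≤-trans (+-cancelʳ-≤ (α * q) _ _ (begin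
              τ * (α + τ) + α * q                   ≡⟨ cong (λ t → τ * (α + t) + α * q) (m∸n+n≡m q≤τ) ⟨
              τ * (α + (p + q)) + α * q             ≡⟨ lem₁ τ α p q ⟩
              τ * (α + q) + (τ * p + α * q)         ≤⟨ +-monoʳ-≤ (τ * (α + q)) (+-monoˡ-≤ (α * q) (*-monoˡ-≤ p τ≤α)) ⟩
              τ * (α + q) + (α * p + α * q)         ≡⟨ cong (λ t → τ * (α + q) + t) (trans (sym (*-distribˡ-+ α p q)) (cong (α *_) (m∸n+n≡m q≤τ))) ⟩
              τ * (α + q) + α * τ                   ≤⟨ +-monoʳ-≤ (τ * (α + q)) new≤ ⟩
              τ * (α + q) + (α * q + N)             ≡⟨ lem₂ (τ * (α + q)) (α * q) N ⟩
              τ * (α + q) + N + α * q ∎)) total≤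
            where
            open ≤-Reasoning
            p = τ ∸ q
            lem₁ : ∀ τ α p q → τ * (α + (p + q)) + α * q ≡ τ * (α + q) + (τ * p + α * q)
            lem₁ = solve-∀
            lem₂ : ∀ x y z → x + (y + z) ≡ x + z + y
            lem₂ = solve-∀

        average-translates : length B⁻ ≤ length X →
          length B⁻ * (length X + length B⁻) ≤ ∑ B⁻ (λ b → length (translates X b))
        average-translates τ≤ = arith τ (length X) q (∑ B⁻ (λ b → length (new b))) _ τ≤ many-new total

      -- A single b serves all the sets `X i`, because only the sum of their gains is averaged over
      -- b. Thus the number of summands does not depend on the number of rows i. The term
      -- `length is` is the -1 of each set.
      choose : ∀ {I : Set} (is : List I) (X : I → List (Pt d)) → 0 < length B⁻ →
        (∀ {i} → i ∈ is → Unique (X i) × length B ≤ length (X i)) →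
        ∃ λ b → b ∈ B × length is * (2 * length B) ≤ ∑ is (λ i → length (translates (X i) b)) + length is
      choose is X 0<B⁻ large =
        let (b , b∈ , le) = ∑-≤⇒∃≤ B⁻ {λ _ → length is * (2 * length B)}
                              {λ b → ∑ is (λ i → length (translates (X i) b)) + length is} 0<B⁻ averaged
        in b , B⁻⊆ b∈ , le
        where
        open ≤-Reasoning
        τ' = length B⁻

        one : ∀ {i} → i ∈ is → τ' * (2 * length B) ≤ ∑ B⁻ (λ b → length (translates (X i) b)) + τ'
        one {i} i∈ = let (u , |B|≤X) = large i∈ in begin
          τ' * (2 * length B)                       ≡⟨ cong (λ l → τ' * (length B + l)) (+-identityʳ (length B)) ⟩
          τ' * (length B + length B)                ≤⟨ *-monoʳ-≤ τ' (+-mono-≤ |B|≤X |B|≤) ⟩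
          τ' * (length (X i) + suc τ')              ≡⟨ lem τ' (length (X i)) ⟩
          τ' * (length (X i) + τ') + τ'             ≤⟨ +-monoˡ-≤ τ' (average-translates (X i) u
                                                        (≤-trans (⊆-length (Unique.filter⁺ _ uB) B⁻⊆) |B|≤X)) ⟩
          ∑ B⁻ (λ b → length (translates (X i) b)) + τ' ∎
          where
          lem : ∀ t x → t * (x + suc t) ≡ t * (x + t) + t
          lem = solve-∀

        averaged : ∑ B⁻ (λ _ → length is * (2 * length B)) ≤ ∑ B⁻ (λ b → ∑ is (λ i → length (translates (X i) b)) + length is)
        averaged = begin
          ∑ B⁻ (λ _ → length is * (2 * length B))           ≡⟨ ∑-const B⁻ _ ⟩
          τ' * (length is * (2 * length B))                 ≡⟨ lem τ' (length is) (2 * length B) ⟩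
          length is * (τ' * (2 * length B))                 ≡⟨ ∑-const is _ ⟨
          ∑ is (λ _ → τ' * (2 * length B))                  ≤⟨ ∑-mono is one ⟩
          ∑ is (λ i → ∑ B⁻ (λ b → length (translates (X i) b)) + τ') ≡⟨ ∑-distrib-+ is _ (λ _ → τ') ⟩
          ∑ is (λ i → ∑ B⁻ (λ b → length (translates (X i) b))) + ∑ is (λ _ → τ') ≡⟨ cong₂ _+_ (∑-comm is B⁻ (λ i b → length (translates (X i) b))) (trans (∑-const is τ') (*-comm (length is) τ')) ⟩
          ∑ B⁻ (λ b → ∑ is (λ i → length (translates (X i) b))) + τ' * length is ≡⟨ cong (∑ B⁻ (λ b → ∑ is (λ i → length (translates (X i) b))) +_) (∑-const B⁻ (length is)) ⟨
          ∑ B⁻ (λ b → ∑ is (λ i → length (translates (X i) b))) + ∑ B⁻ (λ _ → length is) ≡⟨ ∑-distrib-+ B⁻ (λ b → ∑ is (λ i → length (translates (X i) b))) (λ _ → length is) ⟨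
          ∑ B⁻ (λ b → ∑ is (λ i → length (translates (X i) b)) + length is) ∎
          where
          lem : ∀ t m s → t * (m * s) ≡ m * (t * s)
          lem = solve-∀

    -- Classically |X + B| ≥ |X| + |B| − 1; for |X| ≥ |B| three elements of B suffice.  Modulo D = φ hi − φ lo,
    -- X + {lo , hi} has one extra point per residue class met by X, and X + b meets new classes for typical b.

    three-translates : ∀ {I : Set} (B : List (Pt d)) → Unique B →
      (∀ {b b'} → b ∈ B → b' ∈ B → φ b ≡ φ b' → b ≡ b') → 2 ≤ length B →
      (is : List I) (X : I → List (Pt d)) → (∀ {i} → i ∈ is → Unique (X i) × length B ≤ length (X i)) →
      ∃ λ B' → B' ⊆ B × length B' ≡ 3 ×
        length is * (2 * length B) ≤ ∑ is (λ i → length (sumset (X i) B')) + length is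
    three-translates B uB φ-inj 2≤B is X large =
      let (lo , lo∈ , lo≤) = minimum φ B (≤-trans (s≤s z≤n) 2≤B)
          (hi , hi∈ , ≤hi) = maximum φ B (≤-trans (s≤s z≤n) 2≤B)
      in with-extremes lo hi lo∈ hi∈ lo≤ ≤hi (extremes-distinct lo hi lo∈ lo≤ ≤hi)
      where
      Triple : Set
      Triple = ∃ λ B' → B' ⊆ B × length B' ≡ 3 ×
        length is * (2 * length B) ≤ ∑ is (λ i → length (sumset (X i) B')) + length is

      triple : ∀ lo b hi → lo ∈ B → b ∈ B → hi ∈ B →
        length is * (2 * length B) ≤ ∑ is (λ i → length (sumset (X i) (lo ∷ b ∷ hi ∷ []))) + length is → Triple
      triple lo b hi lo∈ b∈ hi∈ le = lo ∷ b ∷ hi ∷ [] ,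
        (λ { (here refl) → lo∈ ; (there (here refl)) → b∈ ; (there (there (here refl))) → hi∈ }) , refl , le

      with-extremes : ∀ lo hi → lo ∈ B → hi ∈ B → (∀ {b} → b ∈ B → φ lo ℤ.≤ φ b) →
        (∀ {b} → b ∈ B → φ b ℤ.≤ φ hi) → lo ≢ hi → Triple
      with-extremes lo hi lo∈ hi∈ lo≤ ≤hi lo≢hi =
        let (b , b∈ , le) = Extremes.choose B lo hi lo∈ hi∈ lo≢hi lo≤ ≤hi uB φ-inj is X
                              (∈-length (∈-filter⁺ (λ b → ¬? (b ≟ᵥ hi)) lo∈ lo≢hi)) large
        in triple lo b hi lo∈ b∈ hi∈ le

      extremes-distinct : ∀ lo hi → lo ∈ B → (∀ {b} → b ∈ B → φ lo ℤ.≤ φ b) → (∀ {b} → b ∈ B → φ b ℤ.≤ φ hi) → lo ≢ hi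
      extremes-distinct lo .lo lo∈ lo≤ ≤lo refl = <⇒≱ 2≤B (⊆-length {ys = lo ∷ []} uB λ b∈ → here (φ-inj b∈ lo∈ (φ≡ b∈)))
        where
        φ≡ : ∀ {b} → b ∈ B → φ b ≡ φ lo
        φ≡ b∈ = ℤ.≤-antisym (≤lo b∈) (lo≤ b∈)

  -- Sums over the levels s + 1 , … , s + n

  Σlev : (ℕ → ℕ) → ℕ → ℕ → ℕ
  Σlev f s zero = 0
  Σlev f s (suc n) = f (suc s) + Σlev f (suc s) n

  Σlev-mono : ∀ {f g : ℕ → ℕ} → (∀ s → f (suc s) ≤ g (suc s)) → ∀ s n → Σlev f s n ≤ Σlev g s n
  Σlev-mono f≤g s zero = z≤n
  Σlev-mono f≤g s (suc n) = +-mono-≤ (f≤g s) (Σlev-mono f≤g (suc s) n)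

  Σlev-distrib-+ : ∀ (f g : ℕ → ℕ) s n → Σlev (λ k → f k + g k) s n ≡ Σlev f s n + Σlev g s n
  Σlev-distrib-+ f g s zero = refl
  Σlev-distrib-+ f g s (suc n) rewrite Σlev-distrib-+ f g (suc s) n =
    lem (f (suc s)) (g (suc s)) (Σlev f (suc s) n) (Σlev g (suc s) n)
    where
    lem : ∀ a b c d → a + b + (c + d) ≡ a + c + (b + d)
    lem = solve-∀

  *-distribˡ-Σlev : ∀ c (f : ℕ → ℕ) s n → c * Σlev f s n ≡ Σlev (λ k → c * f k) s n
  *-distribˡ-Σlev c f s zero = *-zeroʳ c
  *-distribˡ-Σlev c f s (suc n) = trans (*-distribˡ-+ c (f (suc s)) _) (cong (λ x → c * f (suc s) + x) (*-distribˡ-Σlev c f (suc s) n))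

  Σlev-const : ∀ c s n → Σlev (λ _ → c) s n ≡ n * c
  Σlev-const c s zero = refl
  Σlev-const c s (suc n) = cong (λ x → c + x) (Σlev-const c (suc s) n)

  ∑-Σlev : ∀ (xs : List X) (f : X → ℕ → ℕ) s n → ∑ xs (λ x → Σlev (f x) s n) ≡ Σlev (λ k → ∑ xs (λ x → f x k)) s n
  ∑-Σlev xs f s zero = ∑≡0 xs (λ _ → refl)
  ∑-Σlev xs f s (suc n) = trans (∑-distrib-+ xs (λ x → f x (suc s)) (λ x → Σlev (f x) (suc s) n))
    (cong (λ y → ∑ xs (λ x → f x (suc s)) + y) (∑-Σlev xs f (suc s) n))

  -- u times the number of levels s with s u ≤ f is the part of f visible at scale u.

  module Levels (u : ℕ) where

    levels : ℕ → ℕ → ℕ → ℕ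
    levels f = Σlev (λ s → ⟦ s * u ≤? f ⟧)

    levels≡0 : ∀ f s n → f < suc s * u → levels f s n ≡ 0
    levels≡0 f s zero _ = refl
    levels≡0 f s (suc n) f< with suc s * u ≤? f
    ... | yes su≤f = ⊥-elim (<⇒≱ f< su≤f)
    ... | no _ = levels≡0 f (suc s) n (≤-trans f< (m≤n+m _ u))

    levels-≤ : ∀ f s n → s * u ≤ f → u * levels f s n + s * u ≤ f
    levels-≤ f s zero su≤f = subst (λ x → x + s * u ≤ f) (sym (*-zeroʳ u)) su≤f
    levels-≤ f s (suc n) su≤f with suc s * u ≤? f
    ... | yes s'u≤f = ≤-trans (≤-reflexive (lem u (levels f (suc s) n) s)) (levels-≤ f (suc s) n s'u≤f)
      where
      lem : ∀ u x s → u * (1 + x) + s * u ≡ u * x + (u + s * u)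
      lem = solve-∀
    ... | no ¬p = subst (λ x → u * x + s * u ≤ f) (sym (levels≡0 f (suc s) n (≤-trans (≰⇒> ¬p) (m≤n+m _ u))))
        (subst (λ x → x + s * u ≤ f) (sym (*-zeroʳ u)) su≤f)

    ≤-levels : ∀ f s n → f < (s + n) * u → f ≤ u * levels f s n + (s * u + u)
    ≤-levels f s zero f< = ≤-trans (<⇒≤ (subst (λ x → f < x * u) (+-identityʳ s) f<)) (≤-trans (m≤m+n (s * u) u) (m≤n+m _ (u * 0)))
    ≤-levels f s (suc n) f< with suc s * u ≤? f
    ... | yes _ = ≤-trans (≤-levels f (suc s) n (subst (λ x → f < x * u) (+-suc s n) f<))
        (≤-reflexive (lem u (levels f (suc s) n) s))
      where
      lem : ∀ u x s → u * x + (u + s * u + u) ≡ u * (1 + x) + (s * u + u)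
      lem = solve-∀
    ... | no ¬p = ≤-trans (<⇒≤ (≰⇒> ¬p)) (≤-trans (≤-reflexive (+-comm u (s * u))) (m≤n+m _ (u * levels f (suc s) n)))

  -- Rows: the fibres of a projection

  module Rows {d} {v : Pt (suc d)} (P : Projection v) (A : List (Pt (suc d))) (uA : Unique A) where

    open Projection P
    open Fibres _≟ᵥ_ π public

    rows : List (Pt d)
    rows = keys A

    row-size : Pt d → ℕ
    row-size k = length (fibre k A)

    ∑-row-size : ∑ rows row-size ≤ length A
    ∑-row-size = ∑-fibres-≤ (keys-unique A) A

    fibre⁻ : ∀ k xs {x} → x ∈ fibre k xs → x ∈ xs × π x ≡ k
    fibre⁻ k xs = ∈-filter⁻ (λ x → π x ≟ᵥ k) {xs = xs}

    fibre⁺ : ∀ {k xs x} → x ∈ xs → π x ≡ k → x ∈ fibre k xs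
    fibre⁺ {k} = ∈-filter⁺ (λ x → π x ≟ᵥ k)

    fibre-unique : ∀ k {xs} → Unique xs → Unique (fibre k xs)
    fibre-unique k = Unique.filter⁺ (λ x → π x ≟ᵥ k)

    over : List (Pt d) → List (Pt (suc d))
    over L = filter (λ a → π a ∈ᵥ? L) A

    over-unique : ∀ L → Unique (over L)
    over-unique L = Unique.filter⁺ (λ a → π a ∈ᵥ? L) uA

    over⁻ : ∀ L {a} → a ∈ over L → a ∈ A × π a ∈ L
    over⁻ L = ∈-filter⁻ (λ a → π a ∈ᵥ? L) {xs = A}

    ∑-row-size≤over : ∀ {L} → Unique L → ∑ L row-size ≤ length (over L)
    ∑-row-size≤over {L} uL = ≤-trans
      (∑-mono L (λ {k} k∈ → ⊆-length (fibre-unique k uA) (λ x∈ → let (x∈A , πx≡k) = fibre⁻ k A x∈ in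
        fibre⁺ (∈-filter⁺ (λ a → π a ∈ᵥ? L) x∈A (subst (_∈ L) (sym πx≡k) k∈)) πx≡k)))
      (∑-fibres-≤ uL (over L))

    sum-row : Pt d → List (Pt (suc d)) → ℕ
    sum-row k A' = length (fibre k (sumset A A'))

    sum-over : List (Pt d) → List (Pt (suc d)) → ℕ
    sum-over D A' = ∑ D (λ k → sum-row k A')

    sum-over≤ : ∀ {D} → Unique D → ∀ A' → sum-over D A' ≤ length (sumset A A')
    sum-over≤ uD A' = ∑-fibres-≤ uD (sumset A A')

    sum-row-mono : ∀ k {A' A''} → A' ⊆ A'' → sum-row k A' ≤ sum-row k A''
    sum-row-mono k {A'} A'⊆ = ⊆-length (fibre-unique k (sumset-unique A A'))
      (λ z∈ → let (z∈s , πz≡k) = fibre⁻ k (sumset A A') z∈ in fibre⁺ (sumset-mono {A = A} id A'⊆ z∈s) πz≡k)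

    fibre-sum≤ : ∀ i j {B'} → B' ⊆ fibre j A → length (sumset (fibre i A) B') ≤ sum-row (i +ᵥ j) B'
    fibre-sum≤ i j {B'} B'⊆ = ⊆-length (sumset-unique (fibre i A) B') (λ z∈ →
      let (a , b , a∈ , b∈ , z≡) = ∈-sumset⁻ (fibre i A) B' z∈
          (a∈A , πa≡i) = fibre⁻ i A a∈
          (b∈A , πb≡j) = fibre⁻ j A (B'⊆ b∈)
      in subst (_∈ fibre (i +ᵥ j) (sumset A B')) (sym z≡)
           (fibre⁺ (∈-sumset⁺ a∈A b∈) (trans (π-+ a b) (cong₂ _+ᵥ_ πa≡i πb≡j))))

    -- D consists of the rows already treated; each of the m rows added to it contributes w points on average.
    record Grown (D : List (Pt d)) (A' : List (Pt (suc d))) (Target : Pt d → Set) (cost w : ℕ) : Set where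
      field
        D⁺ : List (Pt d)
        A⁺ : List (Pt (suc d))
        A⁺⊆ : A⁺ ⊆ A
        A⁺-size : length A⁺ ≤ cost + length A'
        D⁺-unique : Unique D⁺
        D⊆D⁺ : D ⊆ D⁺
        reached : ∀ {k} → Target k → k ∈ D⁺
        m : ℕ
        D⁺-size : length D⁺ ≡ m + length D
        gain : sum-over D A' + m * w ≤ sum-over D⁺ A⁺

    compose : ∀ {D A' S T U c c' w} (O : Grown D A' S c w) → Grown (Grown.D⁺ O) (Grown.A⁺ O) T c' w →
      (∀ {k} → U k → S k ⊎ T k) → Grown D A' U (c + c') w
    compose {D} {A'} {c = c} {c'} {w} O N U⇒ = record
      { D⁺ = N.D⁺ ; A⁺ = N.A⁺ ; A⁺⊆ = N.A⁺⊆
      ; A⁺-size = ≤-trans N.A⁺-size (≤-trans (+-monoʳ-≤ c' O.A⁺-size) (≤-reflexive (lem c c' (length A'))))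
      ; D⁺-unique = N.D⁺-unique
      ; D⊆D⁺ = λ k∈ → N.D⊆D⁺ (O.D⊆D⁺ k∈)
      ; reached = λ Uk → [ (λ Sk → N.D⊆D⁺ (O.reached Sk)) , N.reached ]′ (U⇒ Uk)
      ; m = N.m + O.m
      ; D⁺-size = trans N.D⁺-size (trans (cong (λ x → N.m + x) O.D⁺-size) (sym (+-assoc N.m O.m (length D))))
      ; gain = ≤-trans (≤-reflexive (lem₂ (sum-over D A') N.m O.m w)) (≤-trans (+-monoˡ-≤ (N.m * w) O.gain) N.gain)
      }
      where
      module O = Grown O
      module N = Grown N
      lem : ∀ c c' y → c' + (c + y) ≡ c + c' + y
      lem = solve-∀
      lem₂ : ∀ s n o w → s + (n + o) * w ≡ s + o * w + n * w
      lem₂ = solve-∀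

    module _ {σ w : ℕ} (2≤σ : 2 ≤ σ) (w<2σ : suc w ≤ 2 * σ) (L : List (Pt d)) (uL : Unique L)
      (L-large : ∀ {i} → i ∈ L → σ ≤ row-size i) where

      private
        w≤ : ∀ m S → m * (2 * σ) ≤ S + m → m * w ≤ S
        w≤ m S le = +-cancelʳ-≤ m _ _ (≤-trans (≤-trans (≤-reflexive (lem m w)) (*-monoʳ-≤ m w<2σ)) le)
          where
          lem : ∀ m w → m * w + m ≡ m * suc w
          lem = solve-∀

      -- The row over i + j contains the sum of the rows over i and j. Only the i for which i + j is
      -- outside D enter the averaging, so the three summands are chosen for the rows that are
      -- really added, and rows in D keep what they have.
      grow-one : ∀ {D A'} → Unique D → A' ⊆ A → ∀ j → σ ≤ row-size j →
        Grown D A' (λ k → ∃ λ i → i ∈ L × k ≡ i +ᵥ j) 3 w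
      grow-one {D} {A'} uD A'⊆ j j-large = assemble
        (ThreeTranslates.three-translates φ φ-+ B (Unique.take⁺ σ (fibre-unique j uA)) φ-inj
          (≤-trans 2≤σ (≤-reflexive (sym |B|))) is (λ i → fibre i A)
          (λ {i} i∈ → fibre-unique i uA , ≤-trans (≤-reflexive |B|) (L-large (proj₁ (is⁻ i∈)))))
        where
        new? : ∀ i → Dec (i +ᵥ j ∉ D)
        new? i = ¬? ((i +ᵥ j) ∈ᵥ? D)

        is : List (Pt d)
        is = filter new? L

        is⁻ : ∀ {i} → i ∈ is → i ∈ L × i +ᵥ j ∉ D
        is⁻ = ∈-filter⁻ new? {xs = L}

        -- Row j may be longer than some row i. Cutting it down to σ points ensures |B| ≤ |X i| for
        -- all i in L.
        B : List (Pt (suc d))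
        B = take σ (fibre j A)

        |B| : length B ≡ σ
        |B| = trans (length-take σ (fibre j A)) (m≤n⇒m⊓n≡m j-large)

        B⊆ : B ⊆ fibre j A
        B⊆ = take-⊆ σ (fibre j A)

        φ-inj : ∀ {b b'} → b ∈ B → b' ∈ B → φ b ≡ φ b' → b ≡ b'
        φ-inj {b} {b'} b∈ b'∈ = jointly-injective b b'
          (trans (proj₂ (fibre⁻ j A (B⊆ b∈))) (sym (proj₂ (fibre⁻ j A (B⊆ b'∈)))))

        new : List (Pt d)
        new = map (_+ᵥ j) is

        new-unique : Unique (new ++ D)
        new-unique = Unique.++⁺
          (Unique.map⁺ (λ {x} {y} → +ᵥ-cancelʳ j x y) (Unique.filter⁺ new? uL)) uD
          (λ (k∈ , k∈D) → let (i , i∈ , k≡) = ∈-map⁻ (_+ᵥ j) k∈ in proj₂ (is⁻ i∈) (subst (_∈ D) k≡ k∈D))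

        reach : ∀ {k} → (∃ λ i → i ∈ L × k ≡ i +ᵥ j) → k ∈ new ++ D
        reach (i , i∈ , refl) with (i +ᵥ j) ∈ᵥ? D
        ... | yes k∈ = ∈-++⁺ʳ new k∈
        ... | no k∉ = ∈-++⁺ˡ (∈-map⁺ (_+ᵥ j) (∈-filter⁺ new? i∈ k∉))

        assemble : (∃ λ B' → B' ⊆ B × length B' ≡ 3 ×
            length is * (2 * length B) ≤ ∑ is (λ i → length (sumset (fibre i A) B')) + length is) →
          Grown D A' (λ k → ∃ λ i → i ∈ L × k ≡ i +ᵥ j) 3 w
        assemble (B' , B'⊆ , |B'| , le) = record
          { D⁺ = new ++ D
          ; A⁺ = B' ++ A'
          ; A⁺⊆ = λ x∈ → [ (λ x∈B' → proj₁ (fibre⁻ j A (B⊆ (B'⊆ x∈B')))) , A'⊆ ]′ (∈-++⁻ B' x∈)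
          ; A⁺-size = ≤-reflexive (trans (length-++ B') (cong (_+ length A') |B'|))
          ; D⁺-unique = new-unique
          ; D⊆D⁺ = ∈-++⁺ʳ new
          ; reached = reach
          ; m = length is
          ; D⁺-size = trans (length-++ new) (cong (_+ length D) (length-map (_+ᵥ j) is))
          ; gain = begin
              sum-over D A' + length is * w
                ≡⟨ +-comm _ (length is * w) ⟩
              length is * w + sum-over D A'
                ≤⟨ +-mono-≤ (w≤ (length is) _ (subst (λ l → length is * (2 * l) ≤ ∑ is (λ i → length (sumset (fibre i A) B')) + length is) |B| le)) (∑-mono D (λ {k} _ → sum-row-mono k (∈-++⁺ʳ B'))) ⟩
              ∑ is (λ i → length (sumset (fibre i A) B')) + sum-over D (B' ++ A')
                ≤⟨ +-monoˡ-≤ _ (∑-mono is (λ {i} _ → ≤-trans (fibre-sum≤ i j (B⊆ ∘ B'⊆)) (sum-row-mono (i +ᵥ j) ∈-++⁺ˡ))) ⟩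
              ∑ is (λ i → sum-row (i +ᵥ j) (B' ++ A')) + sum-over D (B' ++ A')
                ≡⟨ cong (_+ sum-over D (B' ++ A')) (∑-map (_+ᵥ j) is (λ k → sum-row k (B' ++ A'))) ⟨
              sum-over new (B' ++ A') + sum-over D (B' ++ A')
                ≡⟨ ∑-++ new D (λ k → sum-row k (B' ++ A')) ⟨
              sum-over (new ++ D) (B' ++ A') ∎
          }
          where open ≤-Reasoning

      grow : ∀ {D A'} → Unique D → A' ⊆ A → ∀ J → (∀ {j} → j ∈ J → σ ≤ row-size j) →
        Grown D A' (_∈ sumset L J) (length J * 3) w
      grow {D} {A'} uD A'⊆ [] _ = record
        { D⁺ = D ; A⁺ = A' ; A⁺⊆ = A'⊆ ; A⁺-size = ≤-refl ; D⁺-unique = uD ; D⊆D⁺ = id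
        ; reached = λ k∈ → let (_ , _ , _ , j∈ , _) = ∈-sumset⁻ L [] k∈ in ⊥-elim (¬Any[] j∈)
        ; m = 0 ; D⁺-size = refl ; gain = ≤-reflexive (+-identityʳ _) }
        where
        ¬Any[] : ∀ {j : Pt d} → ¬ (j ∈ [])
        ¬Any[] ()
      grow {D} {A'} uD A'⊆ (j ∷ J) J-large = chain (grow-one uD A'⊆ j (J-large (here refl)))
        where
        chain : Grown D A' (λ k → ∃ λ i → i ∈ L × k ≡ i +ᵥ j) 3 w → Grown D A' (_∈ sumset L (j ∷ J)) (3 + length J * 3) w
        chain O = compose O (grow (Grown.D⁺-unique O) (Grown.A⁺⊆ O) J (J-large ∘ there)) split
          where
          split : ∀ {k} → k ∈ sumset L (j ∷ J) → (∃ λ i → i ∈ L × k ≡ i +ᵥ j) ⊎ k ∈ sumset L J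
          split k∈ with ∈-sumset⁻ L (j ∷ J) k∈
          ... | i , _ , i∈ , here refl , k≡ = inj₁ (i , i∈ , k≡)
          ... | i , j' , i∈ , there j'∈ , k≡ = inj₂ (subst (_∈ sumset L J) (sym k≡) (∈-sumset⁺ i∈ j'∈))

    module _ (u h K' : ℕ) (2≤u : 2 ≤ u) (h<2u : suc h ≤ 2 * u) (L J : ℕ → List (Pt d)) (uL : ∀ s → Unique (L s))
      (L-large : ∀ s {i} → i ∈ L s → s * u ≤ row-size i) (J⊆L : ∀ s → J s ⊆ L s) (|J|≤ : ∀ s → length (J s) ≤ K') where

      private
        W : ℕ → ℕ
        W s = length (sumset (L s) (J s))

        sh<2su : ∀ s → suc (suc s * h) ≤ 2 * (suc s * u)
        sh<2su s = begin
          suc (suc s * h)            ≤⟨ m≤m+n _ s ⟩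
          suc (suc s * h) + s        ≡⟨ lem₁ s h ⟩
          suc s * suc h              ≤⟨ *-monoʳ-≤ (suc s) h<2u ⟩
          suc s * (2 * u)            ≡⟨ lem₂ (suc s) u ⟩
          2 * (suc s * u) ∎
          where
          open ≤-Reasoning
          lem₁ : ∀ s h → suc (suc s * h) + s ≡ suc s * suc h
          lem₁ = solve-∀
          lem₂ : ∀ s u → s * (2 * u) ≡ 2 * (s * u)
          lem₂ = solve-∀

        -- Each of the d old rows releases one h of its reserve (s + 1) h, and each of the m new
        -- rows brings (s + 1) h. This pays h for every row of the present level and leaves s h in
        -- reserve for each row.
        arith : ∀ {ws l d m s g g'} → ws ≤ m + d → h * (l + suc s * d) ≤ g → g + m * (suc s * h) ≤ g' →
          h * (ws + l + s * (m + d)) ≤ g'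
        arith {ws} {l} {d'} {m} {s} {g} {g'} ws≤ ih gain = begin
          h * (ws + l + s * (m + d'))            ≤⟨ *-monoʳ-≤ h (+-monoˡ-≤ (s * (m + d')) (+-monoˡ-≤ l ws≤)) ⟩
          h * (m + d' + l + s * (m + d'))        ≡⟨ lem h m d' l s ⟩
          h * (l + suc s * d') + m * (suc s * h) ≤⟨ +-monoˡ-≤ _ ih ⟩
          g + m * (suc s * h)                    ≤⟨ gain ⟩
          g' ∎
          where
          open ≤-Reasoning
          lem : ∀ h m d l s → h * (m + d + l + s * (m + d)) ≡ h * (l + suc s * d) + m * (suc s * h)
          lem = solve-∀

      State : ℕ → ℕ → Set
      State s n = ∃ λ A' → ∃ λ D → A' ⊆ A × length A' ≤ n * (K' * 3) × Unique D ×
        h * (Σlev W s n + s * length D) ≤ sum-over D A'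

      -- The levels are treated from the top down; each row in D, having weight more than s h, holds s h in reserve
      -- for the remaining levels s , … , 1.
      climb : ∀ s n → State s n
      climb s zero = [] , [] , (λ ()) , z≤n , [] , ≤-reflexive (trans (cong (h *_) (*-zeroʳ s)) (*-zeroʳ h))
      climb s (suc n) = step (climb (suc s) n)
        where
        step : State (suc s) n → State s (suc n)
        step (A' , D , A'⊆ , |A'|≤ , uD , ih) = finish
          (grow (≤-trans 2≤u (m≤m+n u (s * u))) (sh<2su s) (L (suc s)) (uL (suc s)) (L-large (suc s))
             uD A'⊆ (J (suc s)) (λ j∈ → L-large (suc s) (J⊆L (suc s) j∈)))
          where
          finish : Grown D A' (_∈ sumset (L (suc s)) (J (suc s))) (length (J (suc s)) * 3) (suc s * h) → State s (suc n)
          finish G = G.A⁺ , G.D⁺ , G.A⁺⊆ ,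
            ≤-trans G.A⁺-size (+-mono-≤ (*-monoˡ-≤ 3 (|J|≤ (suc s))) |A'|≤) , G.D⁺-unique ,
            subst (λ l → h * (W (suc s) + Σlev W (suc s) n + s * l) ≤ sum-over G.D⁺ G.A⁺) (sym G.D⁺-size)
              (arith {W (suc s)} {Σlev W (suc s) n} {length D} {G.m} {s} W≤ ih G.gain)
            where
            module G = Grown G
            W≤ : W (suc s) ≤ G.m + length D
            W≤ = subst (W (suc s) ≤_) G.D⁺-size (⊆-length (sumset-unique (L (suc s)) (J (suc s))) G.reached)

  -- The induction on the dimension

  module _ {d} {Y : Set} (_≟_ : DecidableEquality Y) (_⊕_ : Y → Y → Y)
    (⊕-cancelˡ : ∀ y {a b} → y ⊕ a ≡ y ⊕ b → a ≡ b)
    (κ : Pt d → Y) (κ-+ : ∀ x y → κ (x +ᵥ y) ≡ κ x ⊕ κ y) where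

    open Fibres _≟_ κ using (reps; reps-⊆; keys; keys-unique)

    -- 2 C c suitable translates of B would give C c |B| sums, whereas A + A' has at most C |A|
    -- elements.
    not-heavy : ∀ (A B : List (Pt d)) kB C c → 1 ≤ C → Unique B → B ⊆ A → (∀ {b} → b ∈ B → κ b ∈ kB) →
      0 < length (keys A) → 2 * (2 * C * c * length kB) ≤ length (keys A) →
      (∀ {A'} → A' ⊆ A → length A' ≤ 2 * C * c → length (sumset A A') ≤ C * length A) →
      c * length B ≤ length A
    not-heavy A B kB C@(suc _) c 1≤C uB B⊆A κB 0<keys big small =
      let (A' , A'⊆ , |A'|≤ , le) = Spreading.spread _≟_ _⊕_ ⊕-cancelˡ κ κ-+ {B} {reps A} {kB} uB κB (keys-unique A)
                                      (subst (0 <_) |keys| 0<keys) (2 * C * c)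
                                      (≤-trans big (≤-reflexive |keys|))
          A'⊆A = λ {x} (x∈ : x ∈ A') → reps-⊆ A (A'⊆ x∈)
      in *-cancelˡ-≤ (2 * C) (≤-trans (≤-reflexive (sym (*-assoc (2 * C) c (length B))))
           (≤-trans le (≤-trans (*-monoʳ-≤ 2 (≤-trans (length-sumset-mono B⊆A id) (small A'⊆A |A'|≤)))
             (≤-reflexive (sym (*-assoc 2 C (length A)))))))
      where
      |keys| : length (keys A) ≡ length (reps A)
      |keys| = length-map κ (reps A)

  -- The inequality |A + A'| ≥ (2ᵈ - 1/q) |A| with its denominator cleared, hence a decidable
  -- statement about natural numbers.
  Good : ∀ {d} → ℕ → ℕ → List (Pt d) → Set
  Good {d} q K A = ∃ λ A' → A' ⊆ A × length A' ≤ K × q * (2 ^ d * length A) ≤ q * length (sumset A A') + length A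

  good? : ∀ {d} q K (A : List (Pt d)) → Dec (Good q K A)
  good? {d} q K A = ∃⊆? (λ A' → q * (2 ^ d * length A) ≤? q * length (sumset A A') + length A) K A

  module _ {d} {v : Pt (suc d)} (P : Projection v) (A : List (Pt (suc d))) (uA : Unique A) where

    open Projection P
    open Rows P A uA

    -- Each row of A, translated into S, contains a last point before leaving S in direction v.
    rows-≤-exits : ∀ S a₀ → (∀ {x} → x ∈ A → x +ᵥ a₀ ∈ S) →
      length rows ≤ length (filter (λ z → ¬? (z ∈ᵥ? S)) (map (_+ᵥ v) S))
    rows-≤-exits S a₀ A+a₀⊆S = begin
      length rows                        ≡⟨ length-map (_+ᵥ π a₀) rows ⟨
      length (map (_+ᵥ π a₀) rows)       ≤⟨ ⊆-length (Unique.map⁺ (λ {x} {y} → +ᵥ-cancelʳ (π a₀) x y) (keys-unique A)) included ⟩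
      length (map π exits)               ≡⟨ length-map π exits ⟩
      length exits ∎
      where
      open ≤-Reasoning
      exits : List (Pt (suc d))
      exits = filter (λ z → ¬? (z ∈ᵥ? S)) (map (_+ᵥ v) S)

      included : map (_+ᵥ π a₀) rows ⊆ map π exits
      included k∈ =
        let (k , k∈rows , eq) = ∈-map⁻ (_+ᵥ π a₀) k∈
            (a , a∈ , k≡) = ∈-keys⁻ {A} k∈rows
            (y , y∈ , πy≡ , y+v∉) = last-before-exit φ φ-+ v φ-v S (λ y → π y ≡ π (a +ᵥ a₀))
                                       (λ {y} πy≡ → trans (π-v y) πy≡) (A+a₀⊆S a∈) refl
        in subst (_∈ map π exits)
             (trans (π-v y) (trans πy≡ (trans (π-+ a a₀) (trans (cong (_+ᵥ π a₀) (sym k≡)) (sym eq)))))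
             (∈-map⁺ π (∈-filter⁺ (λ z → ¬? (z ∈ᵥ? S)) (∈-map⁺ (_+ᵥ v) y∈) y+v∉))

  -- λ', μ and ρ account for the points of A in the levels, lost by rounding to multiples of u, and in the largest rows;
  -- ω = u Ω is the total size of the sets L(s) + J(s), scaled by u.

  assemble-bounds : ∀ q P T X g λ' μ ρ ω Ω → g ≡ q * (8 * P + 2) → T ≤ λ' + μ + ρ → g * μ ≤ T → g * ρ ≤ T → λ' ≤ T →
    g * (P * λ') ≤ g * ω + λ' + P * T → 2 * ω ≤ X + Ω → g * Ω ≤ ω → ω ≤ X → X ≤ 2 * P * T →
    q * (2 * P * T) ≤ q * X + T
  -- After multiplication by g the loss is (8 P + 2) T: 4 P T from `μ` and `ρ`, (2 P + 2) T from
  -- `level≤`, and 2 P T from `Ω`. This is why g is q (8 P + 2).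
  assemble-bounds q P T X g λ' μ ρ ω Ω g≡ T≤ μ≤ ρ≤ λ≤ level≤ 2ω≤ Ω≤ ω≤ X≤ = *-cancelˡ-≤ (8 * P + 2) {{>-nonZero (≤-trans (s≤s z≤n) (m≤n+m 2 (8 * P)))}} (begin
    (8 * P + 2) * (q * (2 * P * T))   ≡⟨ lem₁ (8 * P + 2) q P T ⟩
    2 * (P * (q * (8 * P + 2) * T))   ≡⟨ cong (λ x → 2 * (P * (x * T))) g≡ ⟨
    2 * (P * (g * T))                 ≤⟨ *-monoʳ-≤ 2 (*-monoʳ-≤ P gT≤) ⟩
    2 * (P * (g * λ' + 2 * T))        ≡⟨ lem₂ P g λ' T ⟩
    2 * (g * (P * λ')) + 4 * (P * T)  ≤⟨ +-monoˡ-≤ _ (*-monoʳ-≤ 2 level≤) ⟩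
    2 * (g * ω + λ' + P * T) + 4 * (P * T) ≡⟨ lem₃ g ω λ' (P * T) ⟩
    g * (2 * ω) + (2 * λ' + 6 * (P * T)) ≤⟨ +-mono-≤ g2ω≤ (+-monoˡ-≤ _ (*-monoʳ-≤ 2 λ≤)) ⟩
    g * X + 2 * P * T + (2 * T + 6 * (P * T)) ≡⟨ cong (λ x → x * X + 2 * P * T + (2 * T + 6 * (P * T))) g≡ ⟩
    q * (8 * P + 2) * X + 2 * P * T + (2 * T + 6 * (P * T)) ≡⟨ lem₄ q P X T ⟩
    (8 * P + 2) * (q * X + T) ∎)
    where
    open ≤-Reasoning
    lem₁ : ∀ k q P T → k * (q * (2 * P * T)) ≡ 2 * (P * (q * k * T))
    lem₁ = solve-∀
    lem₂ : ∀ P g l T → 2 * (P * (g * l + 2 * T)) ≡ 2 * (g * (P * l)) + 4 * (P * T)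
    lem₂ = solve-∀
    lem₃ : ∀ g o l x → 2 * (g * o + l + x) + 4 * x ≡ g * (2 * o) + (2 * l + 6 * x)
    lem₃ = solve-∀
    lem₄ : ∀ q P X T → q * (8 * P + 2) * X + 2 * P * T + (2 * T + 6 * (P * T)) ≡ (8 * P + 2) * (q * X + T)
    lem₄ = solve-∀
    lem₅ : ∀ g l m r → g * (l + m + r) ≡ g * l + (g * m + g * r)
    lem₅ = solve-∀
    gT≤ : g * T ≤ g * λ' + 2 * T
    gT≤ = begin
      g * T                     ≤⟨ *-monoʳ-≤ g T≤ ⟩
      g * (λ' + μ + ρ)          ≡⟨ lem₅ g λ' μ ρ ⟩
      g * λ' + (g * μ + g * ρ)  ≤⟨ +-monoʳ-≤ (g * λ') (+-mono-≤ μ≤ (≤-trans ρ≤ (≤-reflexive (sym (+-identityʳ T))))) ⟩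
      g * λ' + 2 * T ∎
    g2ω≤ : g * (2 * ω) ≤ g * X + 2 * P * T
    g2ω≤ = begin
      g * (2 * ω)        ≤⟨ *-monoʳ-≤ g 2ω≤ ⟩
      g * (X + Ω)        ≡⟨ *-distribˡ-+ g X Ω ⟩
      g * X + g * Ω      ≤⟨ +-monoʳ-≤ (g * X) (≤-trans Ω≤ (≤-trans ω≤ X≤)) ⟩
      g * X + 2 * P * T ∎

  -- With m rows, u is T / (g m) rounded down. Then rounding all rows to multiples of u loses at
  -- most m u ≤ T / g, and m ≤ T / g² makes u at least g.
  scale : ∀ T g m → 1 ≤ g → 1 ≤ m → g * (g * m) ≤ T → ∃ λ u → g ≤ u × u * (g * m) ≤ T × T ≤ 2 * (g * m) * u
  scale T g@(suc _) m@(suc _) _ _ ggm≤ = u , g≤u , u≤ , ≤-trans (<⇒≤ T<) (begin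
      suc u * (g * m)        ≤⟨ *-monoˡ-≤ (g * m) (≤-trans (+-monoˡ-≤ u (≤-trans (s≤s z≤n) g≤u)) (≤-reflexive (cong (λ x → u + x) (sym (+-identityʳ u))))) ⟩
      2 * u * (g * m)        ≡⟨ lem u (g * m) ⟩
      2 * (g * m) * u ∎)
    where
    open ≤-Reasoning
    lem : ∀ u x → 2 * u * x ≡ 2 * x * u
    lem = solve-∀
    u = T / (g * m)
    u≤ : u * (g * m) ≤ T
    u≤ = ≤-trans (m≤n+m (u * (g * m)) (T % (g * m))) (≤-reflexive (sym (m≡m%n+[m/n]*n T (g * m))))
    T< : T < suc u * (g * m)
    T< = begin-strict
      T                             ≡⟨ m≡m%n+[m/n]*n T (g * m) ⟩
      T % (g * m) + u * (g * m)     <⟨ +-monoˡ-< (u * (g * m)) (m%n<n T (g * m)) ⟩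
      suc u * (g * m) ∎
    g≤u : g ≤ u
    g≤u = ≮⇒≥ (λ u<g → <⇒≱ T< (≤-trans (*-monoˡ-≤ (g * m) u<g) ggm≤))

  -- A set consisting of few lines, cut into levels

  module LevelStep {d} (C g r t' K' K : ℕ) (1≤C : 1 ≤ C) (2≤g : 2 ≤ g) (r≥ : 4 * g * (2 * C * g) ≤ r)
    (ih : ∀ L → Unique L → Spread t' L → Good {d} g K' L)
    (A : List (Pt (suc d))) (uA : Unique A) (spread-A : Spread (2 * (2 * C * (g * r) * t')) A)
    (small : ∀ {A'} → A' ⊆ A → length A' ≤ K → length (sumset A A') ≤ C * length A)
    (K≥₁ : 2 * C * g ≤ K) (K≥₂ : 2 * C * (g * r) ≤ K) (K≥₃ : r * (K' * 3) ≤ K)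
    {v : Pt (suc d)} (Pr : Projection v) (u : ℕ) (g≤u : g ≤ u) where

    open Projection Pr
    open Rows Pr A uA
    open Levels u

    private
      P = 2 ^ d
      T = length A

      2≤u : 2 ≤ u
      2≤u = ≤-trans 2≤g g≤u

      instance
        u≢0 : NonZero u
        u≢0 = >-nonZero (≤-trans (s≤s z≤n) 2≤u)
        g≢0 : NonZero g
        g≢0 = >-nonZero (≤-trans (s≤s z≤n) 2≤g)
        C≢0 : NonZero C
        C≢0 = >-nonZero 1≤C
        r≢0 : NonZero r
        r≢0 = >-nonZero (≤-trans (>-nonZero⁻¹ _ {{4g*2Cg≢0}}) r≥)
          where
          4g*2Cg≢0 : NonZero (4 * g * (2 * C * g))
          4g*2Cg≢0 = m*n≢0 (4 * g) (2 * C * g) {{m*n≢0 4 g}} {{m*n≢0 (2 * C) g {{m*n≢0 2 C}}}}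

    L : ℕ → List (Pt d)
    L s = filter (λ k → s * u ≤? row-size k) rows

    L-unique : ∀ s → Unique (L s)
    L-unique s = Unique.filter⁺ (λ k → s * u ≤? row-size k) (keys-unique A)

    L-large : ∀ s {k} → k ∈ L s → s * u ≤ row-size k
    L-large s k∈ = proj₂ (∈-filter⁻ (λ k → s * u ≤? row-size k) {xs = rows} k∈)

    |L| : ℕ → ℕ
    |L| s = length (L s)

    |L|*su≤ : ∀ s → |L| s * (s * u) ≤ length (over (L s))
    |L|*su≤ s = ≤-trans (≤-reflexive (sym (∑-const (L s) (s * u))))
      (≤-trans (∑-mono (L s) (L-large s)) (∑-row-size≤over (L-unique s)))

    over-⊆ : ∀ s → over (L s) ⊆ A
    over-⊆ s a∈ = proj₁ (over⁻ (L s) a∈)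

    Λ : ℕ
    Λ = Σlev |L| 0 r

    uΛ≡ : u * Λ ≡ ∑ rows (λ k → u * levels (row-size k) 0 r)
    uΛ≡ = trans (cong (u *_) (trans (Σlev-cong 0 r)
        (sym (∑-Σlev rows (λ k s → ⟦ s * u ≤? row-size k ⟧) 0 r))))
      (*-distribˡ-∑ u rows _)
      where
      Σlev-cong : ∀ s n → Σlev |L| s n ≡ Σlev (λ s → ∑ rows (λ k → ⟦ s * u ≤? row-size k ⟧)) s n
      Σlev-cong s zero = refl
      Σlev-cong s (suc n) = cong₂ _+_ (length-filter≡count (λ k → suc s * u ≤? row-size k) rows) (Σlev-cong (suc s) n)

    uΛ≤T : u * Λ ≤ T
    uΛ≤T = ≤-trans (≤-reflexive uΛ≡) (≤-trans
      (∑-mono rows (λ {k} _ → ≤-trans (m≤m+n _ 0) (levels-≤ (row-size k) 0 r z≤n)))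
      ∑-row-size)

    T≤ : T ≤ u * Λ + length rows * u + length (over (L r))
    T≤ = begin
      T                                      ≤⟨ length≤∑-fibres {zs = A} ∈-keys ⟩
      ∑ rows row-size                        ≤⟨ ∑-mono rows (λ {k} _ → pointwise (row-size k)) ⟩
      ∑ rows (λ k → u * levels (row-size k) 0 r + u + ⟦ r * u ≤? row-size k ⟧ * row-size k)
        ≡⟨ ∑-distrib-+ rows _ _ ⟩
      ∑ rows (λ k → u * levels (row-size k) 0 r + u) + ∑ rows (λ k → ⟦ r * u ≤? row-size k ⟧ * row-size k)
        ≡⟨ cong₂ _+_ (∑-distrib-+ rows _ _) (sym (∑-filter (λ k → r * u ≤? row-size k) rows row-size)) ⟩
      ∑ rows (λ k → u * levels (row-size k) 0 r) + ∑ rows (λ _ → u) + ∑ (L r) row-size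
        ≤⟨ +-mono-≤ (≤-reflexive (cong₂ _+_ (sym uΛ≡) (∑-const rows u))) (∑-row-size≤over (L-unique r)) ⟩
      u * Λ + length rows * u + length (over (L r)) ∎
      where
      open ≤-Reasoning
      pointwise : ∀ f → f ≤ u * levels f 0 r + u + ⟦ r * u ≤? f ⟧ * f
      pointwise f = dec (r * u ≤? f)
        where
        dec : (p : Dec (r * u ≤ f)) → f ≤ u * levels f 0 r + u + ⟦ p ⟧ * f
        dec (yes _) = ≤-trans (≤-reflexive (sym (*-identityˡ f))) (m≤n+m (1 * f) (u * levels f 0 r + u))
        dec (no ¬p) = ≤-trans (≤-levels f 0 r (≰⇒> ¬p)) (m≤m+n _ 0)

    -- There are at most T / (r u) rows with r u points, hence at most 2 g / r times the number of
    -- all rows. As r is at least 8 C g², these rows are few enough for `not-heavy`, applied to `π`.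
    top-light : T ≤ 2 * (g * length rows) * u → 0 < length rows → g * length (over (L r)) ≤ T
    top-light T≤2gmu 0<rows = not-heavy _≟ᵥ_ _+ᵥ_ (λ y {a} {b} → +ᵥ-cancelˡ y a b) π π-+ A (over (L r)) (L r) C g 1≤C
      (over-unique (L r)) (over-⊆ r) (λ a∈ → proj₂ (over⁻ (L r) a∈)) 0<rows few
      (λ A'⊆ |A'|≤ → small A'⊆ (≤-trans |A'|≤ K≥₁))
      where
      open ≤-Reasoning
      lem₁ : ∀ g n l → 2 * g * (2 * (n * l)) ≡ l * (4 * g * n)
      lem₁ = solve-∀
      few : 2 * (2 * C * g * |L| r) ≤ length rows
      few = *-cancelˡ-≤ (2 * g) {{m*n≢0 2 g}} (*-cancelʳ-≤ _ _ u (begin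
        2 * g * (2 * (2 * C * g * |L| r)) * u    ≡⟨ cong (_* u) (lem₁ g (2 * C * g) (|L| r)) ⟩
        |L| r * (4 * g * (2 * C * g)) * u        ≤⟨ *-monoˡ-≤ u (*-monoʳ-≤ (|L| r) r≥) ⟩
        |L| r * r * u                            ≡⟨ *-assoc (|L| r) r u ⟩
        |L| r * (r * u)                          ≤⟨ |L|*su≤ r ⟩
        length (over (L r))                      ≤⟨ ⊆-length (over-unique (L r)) (over-⊆ r) ⟩
        T                                        ≤⟨ T≤2gmu ⟩
        2 * (g * length rows) * u                ≡⟨ cong (_* u) (*-assoc 2 g (length rows)) ⟨
        2 * g * length rows * u ∎))

    -- A level contained in t' parallel hyperplanes carries few points, since the rows over it lie in t' hyperplanes too.
    degenerate-light : ∀ s n → n ≢ 0ᵥ d → length (Values.keys n (L s)) ≤ t' → g * r * length (over (L s)) ≤ T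
    degenerate-light s n n≢0 few = not-heavy ℚ._≟_ ℚ._+_ (λ y {a} {b} → ℚ+.∙-cancelˡ y a b) (dotℚ (pullback n)) (dotℚ-+ (pullback n))
      A (over (L s)) (Values.keys n (L s)) C (g * r) 1≤C (over-unique (L s)) (over-⊆ s)
      (λ {a} a∈ → subst (_∈ Values.keys n (L s)) (sym (dotℚ-pullback n a)) (Values.∈-keys n (proj₂ (over⁻ (L s) a∈))))
      (≤-trans (s≤s z≤n) t<) (≤-trans (*-monoʳ-≤ 2 (*-monoʳ-≤ (2 * C * (g * r)) few)) (<⇒≤ t<))
      (λ A'⊆ |A'|≤ → small A'⊆ (≤-trans |A'|≤ K≥₂))
      where
      t< : 2 * (2 * C * (g * r) * t') < length (Values.keys (pullback n) A)
      t< = spread-A (pullback n) (λ eq → n≢0 (pullback≡0 n eq))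

    LevelSummand : ℕ → Set
    LevelSummand s = ∃ λ J → J ⊆ L s × length J ≤ K' ×
      r * (g * (P * (u * |L| s))) ≤ r * (g * (u * length (sumset (L s) J)) + u * |L| s) + P * T

    -- A level contributing at most T / (g r) is abandoned with an empty summand; r such losses
    -- amount to T / g. Any other level is too heavy for `degenerate-light`, so it is spread and
    -- induction applies. The factor r in `LevelSummand` clears this denominator.
    level-summand : ∀ s → LevelSummand (suc s)
    level-summand s = decide (g * r * (u * |L| (suc s)) ≤? T)
      where
      open ≤-Reasoning
      ℓ = |L| (suc s)
      decide : Dec (g * r * (u * ℓ) ≤ T) → LevelSummand (suc s)
      decide (yes light) = [] , (λ ()) , z≤n , ≤-trans (≤-reflexive (lem r g P (u * ℓ))) (≤-trans (*-monoʳ-≤ P light) (m≤n+m (P * T) _))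
        where
        lem : ∀ r g P x → r * (g * (P * x)) ≡ P * (g * r * x)
        lem = solve-∀
      decide (no heavy) = from-ih (ih (L (suc s)) (L-unique (suc s)) spread-L)
        where
        uℓ≤ : u * ℓ ≤ length (over (L (suc s)))
        uℓ≤ = ≤-trans (≤-reflexive (*-comm u ℓ)) (≤-trans (*-monoʳ-≤ ℓ (m≤m+n u (s * u))) (|L|*su≤ (suc s)))

        spread-L : Spread t' (L (suc s))
        spread-L n n≢0 = ≰⇒> (λ few → heavy (≤-trans (*-monoʳ-≤ (g * r) uℓ≤) (degenerate-light (suc s) n n≢0 few)))

        from-ih : Good g K' (L (suc s)) → LevelSummand (suc s)
        from-ih (J , J⊆ , |J|≤ , le) = J , J⊆ , |J|≤ , (begin
          r * (g * (P * (u * ℓ)))                                  ≡⟨ lem₁ r g P u ℓ ⟩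
          r * (u * (g * (P * ℓ)))                                  ≤⟨ *-monoʳ-≤ r (*-monoʳ-≤ u le) ⟩
          r * (u * (g * length (sumset (L (suc s)) J) + ℓ))        ≡⟨ lem₂ r u g (length (sumset (L (suc s)) J)) ℓ ⟩
          r * (g * (u * length (sumset (L (suc s)) J)) + u * ℓ)    ≤⟨ m≤m+n _ (P * T) ⟩
          r * (g * (u * length (sumset (L (suc s)) J)) + u * ℓ) + P * T ∎)
          where
          lem₁ : ∀ r g P u l → r * (g * (P * (u * l))) ≡ r * (u * (g * (P * l)))
          lem₁ = solve-∀
          lem₂ : ∀ r u g w l → r * (u * (g * w + l)) ≡ r * (g * (u * w) + u * l)
          lem₂ = solve-∀

    Summands : Set
    Summands = ∃ λ (J : ℕ → List (Pt d)) → (∀ s → J s ⊆ L s) × (∀ s → length (J s) ≤ K') ×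
      (∀ s → r * (g * (P * (u * |L| (suc s)))) ≤
             r * (g * (u * length (sumset (L (suc s)) (J (suc s)))) + u * |L| (suc s)) + P * T)

    summands : Summands
    summands = J , J⊆ , |J|≤ , λ s → proj₂ (proj₂ (proj₂ (level-summand s)))
      where
      J : ℕ → List (Pt d)
      J zero = []
      J (suc s) = proj₁ (level-summand s)
      J⊆ : ∀ s → J s ⊆ L s
      J⊆ (suc s) = proj₁ (proj₂ (level-summand s))
      |J|≤ : ∀ s → length (J s) ≤ K'
      |J|≤ zero = z≤n
      |J|≤ (suc s) = proj₁ (proj₂ (proj₂ (level-summand s)))

    combine-levels : ∀ (W : ℕ → ℕ) → (∀ s → r * (g * (P * (u * |L| (suc s)))) ≤ r * (g * (u * W (suc s)) + u * |L| (suc s)) + P * T) →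
      g * (P * (u * Λ)) ≤ g * (u * Σlev W 0 r) + u * Λ + P * T
    combine-levels W level≤ = *-cancelˡ-≤ r (begin
      r * (g * (P * (u * Λ)))                            ≡⟨ lem₁ r g P u Λ ⟩
      r * (g * (P * u)) * Λ                              ≡⟨ *-distribˡ-Σlev (r * (g * (P * u))) |L| 0 r ⟩
      Σlev (λ s → r * (g * (P * u)) * |L| s) 0 r          ≤⟨ Σlev-mono (λ s → ≤-trans (≤-reflexive (sym (lem₁ r g P u (|L| (suc s))))) (≤-trans (level≤ s) (≤-reflexive (lem₂ r g u (W (suc s)) (|L| (suc s)) (P * T))))) 0 r ⟩
      Σlev (λ s → r * g * u * W s + (r * u * |L| s + P * T)) 0 r ≡⟨ Σlev-distrib-+ (λ s → r * g * u * W s) (λ s → r * u * |L| s + P * T) 0 r ⟩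
      Σlev (λ s → r * g * u * W s) 0 r + Σlev (λ s → r * u * |L| s + P * T) 0 r ≡⟨ cong₂ _+_ (sym (*-distribˡ-Σlev (r * g * u) W 0 r)) (Σlev-distrib-+ (λ s → r * u * |L| s) (λ _ → P * T) 0 r) ⟩
      r * g * u * Σlev W 0 r + (Σlev (λ s → r * u * |L| s) 0 r + Σlev (λ _ → P * T) 0 r) ≡⟨ cong (λ x → r * g * u * Σlev W 0 r + x) (cong₂ _+_ (sym (*-distribˡ-Σlev (r * u) |L| 0 r)) (Σlev-const (P * T) 0 r)) ⟩
      r * g * u * Σlev W 0 r + (r * u * Λ + r * (P * T)) ≡⟨ lem₃ r g u (Σlev W 0 r) Λ (P * T) ⟩
      r * (g * (u * Σlev W 0 r) + u * Λ + P * T) ∎)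
      where
      open ≤-Reasoning
      lem₁ : ∀ r g P u l → r * (g * (P * (u * l))) ≡ r * (g * (P * u)) * l
      lem₁ = solve-∀
      lem₂ : ∀ r g u w l x → r * (g * (u * w) + u * l) + x ≡ r * g * u * w + (r * u * l + x)
      lem₂ = solve-∀
      lem₃ : ∀ r g u w l x → r * g * u * w + (r * u * l + r * x) ≡ r * (g * (u * w) + u * l + x)
      lem₃ = solve-∀

    bounded-summand : C ≡ 2 * P → ∀ q → g ≡ q * (8 * P + 2) → u * (g * length rows) ≤ T → T ≤ 2 * (g * length rows) * u →
      0 < length rows → Good q K A
    bounded-summand refl q g≡ ugm≤ T≤2gmu 0<rows = from-summands summands
      where
      -- Since 2 s u - 1 ≥ s (2 u - 1), a row reaching level s can be credited with h points for
      -- each of its s levels.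
      h = pred (2 * u)

      suc-h : suc h ≡ 2 * u
      suc-h = suc-pred (2 * u) {{m*n≢0 2 u}}

      u≤h : u ≤ h
      u≤h = s≤s⁻¹ (begin
        suc u     ≤⟨ +-monoˡ-≤ u (≤-trans (s≤s z≤n) 2≤u) ⟩
        u + u     ≡⟨ cong (λ x → u + x) (+-identityʳ u) ⟨
        2 * u     ≡⟨ suc-h ⟨
        suc h ∎)
        where
        open ≤-Reasoning

      lem : ∀ g m u → g * (m * u) ≡ u * (g * m)
      lem = solve-∀

      from-summands : Summands → Good q K A
      from-summands (J , J⊆ , |J|≤ , level≤) =
        from-climb (climb u h K' 2≤u (≤-reflexive suc-h) L J L-unique L-large J⊆ |J|≤ 0 r)
        where
        Ω = Σlev (λ s → length (sumset (L s) (J s))) 0 r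

        from-climb : (∃ λ A' → ∃ λ D → A' ⊆ A × length A' ≤ r * (K' * 3) × Unique D ×
          h * (Ω + 0) ≤ sum-over D A') → Good q K A
        from-climb (A' , D , A'⊆ , |A'|≤ , uD , le) = A' , A'⊆ , ≤-trans |A'|≤ K≥₃ ,
          assemble-bounds q P T S g (u * Λ) (length rows * u) (length (over (L r))) (u * Ω) Ω g≡ T≤
            (≤-trans (≤-reflexive (lem g (length rows) u)) ugm≤) (top-light T≤2gmu 0<rows) uΛ≤T
            (combine-levels (λ s → length (sumset (L s) (J s))) level≤)
            2uΩ≤ (*-monoˡ-≤ Ω g≤u) (≤-trans (*-monoˡ-≤ Ω u≤h) hΩ≤) (small A'⊆ (≤-trans |A'|≤ K≥₃))
          where
          S = length (sumset A A')

          hΩ≤ : h * Ω ≤ S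
          hΩ≤ = ≤-trans (≤-reflexive (cong (h *_) (sym (+-identityʳ Ω)))) (≤-trans le (sum-over≤ uD A'))

          2uΩ≤ : 2 * (u * Ω) ≤ S + Ω
          2uΩ≤ = ≤-trans (≤-reflexive (trans (sym (*-assoc 2 u Ω)) (cong (_* Ω) (sym suc-h))))
            (≤-trans (≤-reflexive (+-comm Ω (h * Ω))) (+-monoˡ-≤ Ω hΩ≤))

  spread⇒length : ∀ {d t} {A : List (Pt (suc d))} → Spread t A → t < length A
  spread⇒length {d} {t} {A} sp = <-≤-trans (sp n (λ ())) (begin
    length (keys A)   ≡⟨ length-map (dotℚ n) (reps A) ⟩
    length (reps A)   ≤⟨ ⊆-length (reps-unique A) (reps-⊆ A) ⟩
    length A ∎)
    where
    open ≤-Reasoning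
    n = 1ℚ ∷ 0ᵥ d
    open Values n

  module _ {d} (C g r t' K' K : ℕ) (1≤C : 1 ≤ C) (2≤g : 2 ≤ g) (r≥ : 4 * g * (2 * C * g) ≤ r)
    (ih : ∀ L → Unique L → Spread t' L → Good {d} g K' L)
    (A : List (Pt (suc d))) (uA : Unique A) (spread-A : Spread (2 * (2 * C * (g * r) * t')) A)
    (K≥₁ : 2 * C * g ≤ K) (K≥₂ : 2 * C * (g * r) ≤ K) (K≥₃ : r * (K' * 3) ≤ K)
    (C≡ : C ≡ 2 * 2 ^ d) (q : ℕ) (g≡ : g ≡ q * (8 * 2 ^ d + 2))
    (small : ∀ {A'} → A' ⊆ A → length A' ≤ K → length (sumset A A') ≤ C * length A) where

    private
      0<A : 0 < length A
      0<A = ≤-trans (s≤s z≤n) (spread⇒length {A = A} spread-A)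

    good-projection : ∀ {v} (Pr : Projection v) → g * (g * length (Rows.rows Pr A uA)) ≤ length A → Good q K A
    good-projection Pr few =
      let (u , g≤u , ugm≤ , T≤) = scale (length A) g (length rows) (≤-trans (s≤s z≤n) 2≤g) 0<rows few
      in LevelStep.bounded-summand C g r t' K' K 1≤C 2≤g r≥ ih A uA spread-A small K≥₁ K≥₂ K≥₃ Pr u g≤u C≡ q g≡ ugm≤ T≤ 0<rows
      where
      open Rows Pr A uA
      0<rows : 0 < length rows
      0<rows = nonempty A 0<A
        where
        nonempty : ∀ xs → 0 < length xs → 0 < length (keys xs)
        nonempty (x ∷ xs) _ = ∈-length (∈-keys {x ∷ xs} (here refl))

    -- With e = 8 g² an almost period has at most 8 |A| / e = |A| / g² exits, and these are at least
    -- as many as the rows.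
    module AP = AlmostPeriods A uA 0<A C (8 * (g * g)) 1≤C

    good-set : 2 ^ suc (C * (8 * (g * g))) + suc (2 * C ^ 2 ^ (C * (8 * (g * g)))) ≤ K →
      suc (2 * C ^ 2 ^ (C * (8 * (g * g)))) ≤ length A → Good q K A
    good-set K≥ A≥ = from-period (AP.almost-period (λ A'⊆ |A'|≤ → small A'⊆ (≤-trans |A'|≤ K≥)) A≥)
      where
      from-period : AP.AlmostPeriod (λ A'⊆ |A'|≤ → small A'⊆ (≤-trans |A'|≤ K≥)) → Good q K A
      from-period (v , v≢0 , S , a₀ , A+a₀⊆S , few) = good-projection Pr (*-cancelˡ-≤ 8 (begin
        8 * (g * (g * length rows))     ≡⟨ lem g (length rows) ⟩
        8 * (g * g) * length rows       ≤⟨ *-monoʳ-≤ (8 * (g * g)) (rows-≤-exits Pr A uA S a₀ A+a₀⊆S) ⟩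
        8 * (g * g) * length (filter (λ z → ¬? (z ∈ᵥ? S)) (map (_+ᵥ v) S)) ≤⟨ few ⟩
        8 * length A ∎))
        where
        open ≤-Reasoning
        Pr = project-along v v≢0
        open Rows Pr A uA using (rows)
        lem : ∀ g m → 8 * (g * (g * m)) ≡ 8 * (g * g) * m
        lem = solve-∀

  -- The induction and its constants

  Claim : ℕ → Set
  Claim d = ∀ q → 1 ≤ q → ∃ λ t → ∃ λ K → ∀ A → Unique A → Spread {d} t A → Good q K A

  claim-zero : Claim 0
  claim-zero q 1≤q = 0 , 1 , λ A uA _ → A , id , |A|≤1 A uA ,
    ≤-trans (*-monoʳ-≤ q (≤-trans (≤-reflexive (*-identityˡ (length A))) (|A|≤ A uA))) (m≤m+n _ (length A))
    where
    |A|≤1 : ∀ (A : List (Pt 0)) → Unique A → length A ≤ 1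
    |A|≤1 A uA = ⊆-length {ys = [] ∷ []} uA (λ { {[]} _ → here refl })

    |A|≤ : ∀ (A : List (Pt 0)) → Unique A → length A ≤ length (sumset A A)
    |A|≤ [] _ = z≤n
    |A|≤ A@(x ∷ _) uA = ≤-trans (|A|≤1 A uA) (∈-length (∈-sumset⁺ {A = A} {B = A} (here refl) (here refl)))

  claim-suc : ∀ {d} → Claim d → Claim (suc d)
  -- The lower dimension is used with error 1/g, since its loss is added to the others and only
  -- their sum has to stay below `1/q`.
  claim-suc {d} claim q 1≤q = from-ih (claim g 1≤g)
    where
    P C g r M N : ℕ
    P = 2 ^ d
    C = 2 * P
    g = q * (8 * P + 2)
    r = 4 * g * (2 * C * g)
    M = suc (2 * C ^ 2 ^ (C * (8 * (g * g))))
    N = 2 ^ suc (C * (8 * (g * g)))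

    2≤g : 2 ≤ g
    2≤g = *-mono-≤ 1≤q (m≤n+m 2 (8 * P))

    1≤g : 1 ≤ g
    1≤g = ≤-trans (s≤s z≤n) 2≤g

    1≤C : 1 ≤ C
    1≤C = m^n>0 2 (suc d)

    from-ih : (∃ λ t → ∃ λ K → ∀ A → Unique A → Spread {d} t A → Good g K A) →
      ∃ λ t → ∃ λ K → ∀ A → Unique A → Spread {suc d} t A → Good q K A
    -- `M` guarantees enough elements of A to serve as shifts in the pigeonhole argument. `n` makes
    -- the values of a functional on A so numerous that the part of A over t' of them is light.
    from-ih (t' , K' , ih) = M + n , K , λ A uA sp → decide A uA sp (good? q K A)
      where
      n K : ℕ
      n = 2 * (2 * C * (g * r) * t')
      -- The sum of all sizes of A' for which A + A' has to be small: tuples, shifts, the two uses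
      -- of `not-heavy`, and the final summand with three elements for each row of each J(s).
      K = (N + M) + (2 * C * g + (2 * C * (g * r) + r * (K' * 3)))

      decide : ∀ A → Unique A → Spread (M + n) A → Dec (Good q K A) → Good q K A
      decide A uA sp (yes good) = good
      decide A uA sp (no ¬good) = good-set C g r t' K' K 1≤C 2≤g ≤-refl ih A uA
        (λ m m≢0 → ≤-<-trans (m≤n+m n M) (sp m m≢0))
        (≤-trans (m≤m+n (2 * C * g) _) (m≤n+m _ (N + M)))
        (≤-trans (m≤m+n (2 * C * (g * r)) _) (≤-trans (m≤n+m _ (2 * C * g)) (m≤n+m _ (N + M))))
        (≤-trans (m≤n+m (r * (K' * 3)) (2 * C * (g * r))) (≤-trans (m≤n+m _ (2 * C * g)) (m≤n+m _ (N + M))))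
        refl q refl small
        (m≤m+n (N + M) _)
        (≤-trans (m≤m+n M n) (<⇒≤ (spread⇒length {A = A} sp)))
        where
        small : ∀ {A'} → A' ⊆ A → length A' ≤ K → length (sumset A A') ≤ C * length A
        -- The negation of `Good` says q |A + A'| + |A| < q C |A|; only the order of magnitude C |A|
        -- is retained.
        small {A'} A'⊆ |A'|≤ = <⇒≤ (*-cancelˡ-< q _ _ (≤-<-trans (m≤m+n _ (length A))
          (≰⇒> (λ le → ¬good (A' , A'⊆ , |A'|≤ , le)))))

  claims : ∀ d → Claim d
  claims zero = claim-zero
  claims (suc d) = claim-suc (claims d)

  -- From natural numbers to rational ε

  private
    ε*↧ε : ∀ ε → ε ℚ.* ι (ℚ.↧ ε) ≡ ι (ℚ.↥ ε)
    ε*↧ε ε@(mkℚ n d-1 _) = trans (cong (ε ℚ.*_) (ι≡fromℤ (ℚ.↧ ε))) (trans (ℚ.toℚᵘ-injective (ℚᵘ.≃-trans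
      (ℚ.toℚᵘ-homo-* ε (fromℤ (ℚ.↧ ε))) (ℚᵘ.*≡* (trans (ℤ.*-identityʳ (n ℤ.* ℚ.↧ ε)) (cong (λ k → n ℤ.* pos k) (sym (*-identityʳ (suc d-1))))))))
      (sym (ι≡fromℤ n)))

    ι-mono : ∀ {m n} → m ≤ n → ι (pos m) ℚ.≤ ι (pos n)
    ι-mono {m} {n} m≤n = subst₂ ℚ._≤_ (sym (ι≡fromℤ (pos m))) (sym (ι≡fromℤ (pos n)))
      (ℚ.*≤* (ℤ.*-monoʳ-≤-nonNeg (pos 1) (ℤ.+≤+ m≤n)))

  -- Let q be the denominator of ε. Then ε q is the numerator, which is at least 1 because ε is
  -- positive, so the loss T is at most ε q T.
  rational-bound : ∀ ε → 0ℚ ℚ.< ε → ∀ C T X → ℚ.↧ₙ ε * (C * T) ≤ ℚ.↧ₙ ε * X + T →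
    (ι (pos C) ℚ.- ε) ℚ.* ι (pos T) ℚ.≤ ι (pos X)
  rational-bound ε@(mkℚ +[1+ n ] d-1 _) 0<ε C T X le = ℚ.*-cancelˡ-≤-pos (ι q) {{ι-pos}} (begin
    ι q ℚ.* ((ι c ℚ.- ε) ℚ.* ι t)                  ≡⟨ solve 4 (λ q c e t → q :* ((c :+ :- e) :* t) := q :* (c :* t) :+ :- ((e :* q) :* t)) refl (ι q) (ι c) ε (ι t) ⟩
    ι q ℚ.* (ι c ℚ.* ι t) ℚ.- (ε ℚ.* ι q) ℚ.* ι t   ≡⟨ cong₂ ℚ._-_ qct (trans (cong (ℚ._* ι t) (ε*↧ε ε)) (trans (sym (ι-* (pos (suc n)) t)) (cong ι (sym (ℤ.pos-* (suc n) T))))) ⟩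
    ι (pos (suc d-1 * (C * T))) ℚ.- ι (pos (suc n * T)) ≤⟨ ℚ.+-mono-≤ (ι-mono le) (ℚ.neg-antimono-≤ (ι-mono (m≤m+n T (n * T)))) ⟩
    ι (pos (suc d-1 * X + T)) ℚ.- ι t              ≡⟨ cong (ℚ._- ι t) (trans (cong ι (ℤ.pos-+ (suc d-1 * X) T)) (ι-+ (pos (suc d-1 * X)) t)) ⟩
    ι (pos (suc d-1 * X)) ℚ.+ ι t ℚ.- ι t          ≡⟨ solve 2 (λ x t → (x :+ t) :+ :- t := x) refl (ι (pos (suc d-1 * X))) (ι t) ⟩
    ι (pos (suc d-1 * X))                          ≡⟨ trans (cong ι (ℤ.pos-* (suc d-1) X)) (ι-* q (pos X)) ⟩
    ι q ℚ.* ι (pos X) ∎)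
    where
    open ℚ.≤-Reasoning
    open +-*-Solver
    q = pos (suc d-1)
    c = pos C
    t = pos T
    ι-pos : ℚ.Positive (ι q)
    ι-pos = subst ℚ.Positive (sym (ι≡fromℤ q)) _
    qct : ι q ℚ.* (ι c ℚ.* ι t) ≡ ι (pos (suc d-1 * (C * T)))
    qct = trans (cong (ι q ℚ.*_) (trans (sym (ι-* c t)) (cong ι (sym (ℤ.pos-* C T)))))
      (trans (sym (ι-* q (pos (C * T)))) (cong ι (sym (ℤ.pos-* (suc d-1) (C * T)))))
  rational-bound (mkℚ (pos zero) d-1 _) (ℚ.*<* (ℤ.+<+ ()))
  rational-bound (mkℚ -[1+ n ] d-1 _) (ℚ.*<* ())

  unique-summand : ∀ {d} {q K} {A : List (Pt d)} → Good q K A → ∃ λ A' → Unique A' × A' ⊆ A × length A' ≤ K ×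
    q * (2 ^ d * length A) ≤ q * length (sumset A A') + length A
  unique-summand {d} {q} {K} {A} (A' , A'⊆ , |A'|≤ , le) =
    deduplicate _≟ᵥ_ A' , DecUnique.deduplicate-! _≟ᵥ_ A' , (λ x∈ → A'⊆ (∈-deduplicate⁻ _≟ᵥ_ A' x∈)) ,
    ≤-trans (length-deduplicate _≟ᵥ_ A') |A'|≤ ,
    ≤-trans le (+-monoˡ-≤ (length A) (*-monoʳ-≤ q (length-sumset-mono {A = A} id (∈-deduplicate⁺ _≟ᵥ_))))

open import Defs
open import Data.Nat using (ℕ; _≤_; _^_)
open import Data.Rational as ℚ using (ℚ; 0ℚ; _<_; _-_; _*_; _/_)
open import Data.Integer using (+_)
open import Data.List using (List; length)
open import Data.List.Relation.Unary.Unique.Propositional using (Unique)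
open import Data.List.Relation.Binary.Subset.Propositional using (_⊆_)
open import Data.Product using (Σ; _×_; _,_)
open import Data.Nat.Properties using (≤-<-trans; 0<1+n)
open import Relation.Nullary using (¬_)

theorem1p4 : (ε : ℚ) → 0ℚ < ε → (d : ℕ) → 1 ≤ d →
    Σ ℕ λ t₀ → (t : ℕ) → t₀ ≤ t →
    Σ ℕ λ K → (A : List (Pt d)) → Unique A →
    ¬ InParallelHyperplanes t A →
    Σ (List (Pt d)) λ A' → Unique A' × A' ⊆ A × length A' ≤ K ×
    ((+ (2 ^ d) / 1 - ε) * (+ length A / 1) ℚ.≤ + length (sumset A A') / 1)
theorem1p4 ε 0<ε d _ =
  let (t₀ , K , good) = claims d (ℚ.↧ₙ ε) 0<1+n
  -- One K serves every t ≥ t₀: a set with more than t values under each functional has more than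
  -- t₀.
  in t₀ , λ t t₀≤t → K , λ A uA ¬covered →
       let (A' , uA' , A'⊆A , |A'|≤K , bound) = unique-summand {q = ℚ.↧ₙ ε}
             (good A uA (λ n n≢0 → ≤-<-trans t₀≤t (spread-intro ¬covered n n≢0)))
       in A' , uA' , A'⊆A , |A'|≤K , rational-bound ε 0<ε (2 ^ d) (length A) (length (sumset A A')) bound
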